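{- There is a linear-time reduction from the $(n,|A|)$-$\exists\forall$-Triangle Problem to the $(k,n')$-king problem with $n' = n+|A|+2$ and $k = n-|A|+3$. That is, there is an algorithm that, given an instance $G$ of the $\exists\forall$-Triangle Problem with parts $A,B,C$ and $n=|A|+|B|+|C|$ vertices in total, constructs, in time linear in the size of the (adjacency matrix) input, i.e. $O(n^2)$, a tournament $T$ on $n'=n+|A|+2$ vertices such that $T$ contains at least $k=n-|A|+3$ kings if and only if $G$ is a yes-instance of the $\exists\forall$-Triangle Problem.
   Context: A tournament is a directed graph such that for every two distinct vertices $u,v$ exactly one of the edges $u\to v$, $v\to u$ is present. A vertex $v$ of a tournament is a king if for every other vertex $u$ there is a directed path from $v$ to $u$ of length (number of edges) at most $2$. The $(k,n)$-king problem: given a tournament on $n$ vertices and a number $k$, output a set of any $k$ distinct kings, or $\bot$ if the tournament does not contain $k$ kings. The $(n,|A|)$-$\exists\forall$-Triangle Problem: the input is an undirected tripartite graph $G$ with parts $A,B,C$ and $n$ vertices in total, where $|A|,|B|,|C|\in\Omega(n)$ (i.e. each part has at least $\delta n$ vertices for some fixed constant $\delta>0$), and in which each vertex has at least one neighbour in each of the two other parts. The instance is a yes-instance if there exists a vertex $a\in A$ such that every edge $(a,c)$ of $G$ with $c\in C$ belongs to some triangle of $G$, i.e. there is $b\in B$ such that $(a,b)$, $(b,c)$ and $(a,c)$ are edges of $G$. -}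

module Defs where

open import Data.Bool using (Bool; true; false; not; _∧_; _xor_; if_then_else_)
open import Data.Fin using (Fin; toℕ; fromℕ<)
open import Data.Fin.Subset using (Subset; _∈_; ∣_∣)
open import Data.Integer using (+_)
open import Data.Nat using (ℕ; suc; pred; _+_; _≤_; _<?_; _≡ᵇ_; _<ᵇ_)
open import Data.Product using (∃; ∃-syntax; _×_)
open import Data.Rational as ℚ using (ℚ)
open import Data.Vec using (tabulate)
open import Relation.Binary.PropositionalEquality using (_≡_; _≢_; refl)
open import Relation.Nullary using (Dec; yes; no; does)

------------------------------------------------------------------------
-- Tournaments and kings

record Tournament (m : ℕ) : Set where
  field
    edge   : Fin m → Fin m → Bool
    irrefl : ∀ v → edge v v ≡ false
    oneWay : ∀ u v → u ≢ v → edge u v xor edge v u ≡ true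

module _ {m : ℕ} (T : Tournament m) where
  open Tournament T

  -- Repeated vertices are not excluded.  This is harmless in the definition
  -- of a king: between distinct vertices, and without loops, a directed walk
  -- of length at most 2 never repeats a vertex.
  data Path : Fin m → Fin m → ℕ → Set where
    here : ∀ {v} → Path v v 0
    step : ∀ {u v w ℓ} → edge u v ≡ true → Path v w ℓ → Path u w (suc ℓ)

  King : Fin m → Set
  King v = ∀ u → u ≢ v → ∃[ ℓ ] (ℓ ≤ 2 × Path v u ℓ)

  -- S is a correct (non-⊥) answer to the (k,m)-king problem on T.
  IsKingSet : ℕ → Subset m → Set
  IsKingSet k S = ∣ S ∣ ≡ k × (∀ {v} → v ∈ S → King v)

  HasKings : ℕ → Set
  HasKings k = ∃ (IsKingSet k)

------------------------------------------------------------------------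
-- The ∃∀-Triangle Problem

data Part : Set where
  A B C : Part

_≟ᴾ_ : (p q : Part) → Dec (p ≡ q)
A ≟ᴾ A = yes refl
A ≟ᴾ B = no λ ()
A ≟ᴾ C = no λ ()
B ≟ᴾ A = no λ ()
B ≟ᴾ B = yes refl
B ≟ᴾ C = no λ ()
C ≟ᴾ A = no λ ()
C ≟ᴾ B = no λ ()
C ≟ᴾ C = yes refl

record TripartiteGraph : Set where
  field
    n          : ℕ
    part       : Fin n → Part
    adj        : Fin n → Fin n → Bool
    adj-sym    : ∀ u v → adj u v ≡ adj v u
    tripartite : ∀ u v → adj u v ≡ true → part u ≢ part v

  partSet : Part → Subset n
  partSet p = tabulate λ v → does (part v ≟ᴾ p)

  size : Part → ℕ
  size p = ∣ partSet p ∣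

-- The admissible inputs: δ is the constant hidden in |A|,|B|,|C| ∈ Ω(n).
record Instance (δ : ℚ) : Set where
  field
    graph : TripartiteGraph
  open TripartiteGraph graph public
  field
    balanced  : ∀ p → δ ℚ.* (+ n ℚ./ 1) ℚ.≤ (+ size p ℚ./ 1)
    neighbour : ∀ v p → p ≢ part v → ∃[ u ] (part u ≡ p × adj v u ≡ true)

YesInstance : ∀ {δ} → Instance δ → Set
YesInstance G =
  ∃[ a ] (part a ≡ A ×
    (∀ c → part c ≡ C → adj a c ≡ true →
      ∃[ b ] (part b ≡ B × adj a b ≡ true × adj b c ≡ true × adj a c ≡ true)))
  where open Instance G

------------------------------------------------------------------------
-- The model of computation: while-programs over a random access memory, with
-- unit cost per syntax node evaluated.  Registers and the cells of
-- two-dimensional arrays hold naturals.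
--
-- Increment and decrement are the only arithmetic, so no cell ever exceeds
-- (largest input value or literal) + (running time).  With a running time
-- polynomial in n all numbers and addresses thus have O(log n) bits, and the
-- unit cost measure is the one of the word RAM.

record Memory : Set where
  constructor mem
  field
    reg : ℕ → ℕ
    arr : ℕ → ℕ → ℕ → ℕ
open Memory public

infix  9 _==_ _<<_
infixr 8 _and_

data Exp : Set where
  lit     : ℕ → Exp
  var     : ℕ → Exp
  get     : ℕ → Exp → Exp → Exp
  inc dec : Exp → Exp

data Test : Set where
  _==_ _<<_ : Exp → Exp → Test
  neg       : Test → Test
  _and_     : Test → Test → Test

infix  7 _:=_
infix  6 ifᶜ_then_else_ while_loop_
infixr 5 _⨾_

data Cmd : Set where
  skip           : Cmd
  _:=_           : ℕ → Exp → Cmd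
  put            : ℕ → Exp → Exp → Exp → Cmd
  _⨾_            : Cmd → Cmd → Cmd
  ifᶜ_then_else_ : Test → Cmd → Cmd → Cmd
  while_loop_    : Test → Cmd → Cmd

⟦_⟧ : Exp → Memory → ℕ
⟦ lit k ⟧       s = k
⟦ var x ⟧       s = reg s x
⟦ get a e f ⟧   s = arr s a (⟦ e ⟧ s) (⟦ f ⟧ s)
⟦ inc e ⟧       s = suc (⟦ e ⟧ s)
⟦ dec e ⟧       s = pred (⟦ e ⟧ s)

⟦_⟧ᵇ : Test → Memory → Bool
⟦ e == f ⟧ᵇ  s = ⟦ e ⟧ s ≡ᵇ ⟦ f ⟧ s
⟦ e << f ⟧ᵇ  s = ⟦ e ⟧ s <ᵇ ⟦ f ⟧ s
⟦ neg t ⟧ᵇ   s = not (⟦ t ⟧ᵇ s)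
⟦ t and u ⟧ᵇ s = ⟦ t ⟧ᵇ s ∧ ⟦ u ⟧ᵇ s

cost : Exp → ℕ
cost (lit k)     = 1
cost (var x)     = 1
cost (get a e f) = 1 + cost e + cost f
cost (inc e)     = 1 + cost e
cost (dec e)     = 1 + cost e

costᵇ : Test → ℕ
costᵇ (e == f)  = 1 + cost e + cost f
costᵇ (e << f)  = 1 + cost e + cost f
costᵇ (neg t)   = 1 + costᵇ t
costᵇ (t and u) = 1 + costᵇ t + costᵇ u

setReg : ℕ → ℕ → Memory → Memory
setReg x k s = mem (λ y → if y ≡ᵇ x then k else reg s y) (arr s)

setArr : ℕ → ℕ → ℕ → ℕ → Memory → Memory
setArr a i j k s = mem (reg s) λ b i′ j′ →
  if (b ≡ᵇ a) ∧ (i′ ≡ᵇ i) ∧ (j′ ≡ᵇ j) then k else arr s b i′ j′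

-- ⟨ P , s ⟩⇓[ t ] s′ : started in s, P halts in s′ after exactly t steps.
data ⟨_,_⟩⇓[_]_ : Cmd → Memory → ℕ → Memory → Set where
  skip    : ∀ {s} → ⟨ skip , s ⟩⇓[ 1 ] s
  assign  : ∀ {s x e} →
            ⟨ x := e , s ⟩⇓[ 1 + cost e ] setReg x (⟦ e ⟧ s) s
  store   : ∀ {s a e f g} →
            ⟨ put a e f g , s ⟩⇓[ 1 + (cost e + cost f + cost g) ]
              setArr a (⟦ e ⟧ s) (⟦ f ⟧ s) (⟦ g ⟧ s) s
  seq     : ∀ {P Q s s′ s″ t t′} →
            ⟨ P , s ⟩⇓[ t ] s′ → ⟨ Q , s′ ⟩⇓[ t′ ] s″ →
            ⟨ P ⨾ Q , s ⟩⇓[ t + t′ ] s″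
  ifTrue  : ∀ {b P Q s s′ t} → ⟦ b ⟧ᵇ s ≡ true →
            ⟨ P , s ⟩⇓[ t ] s′ →
            ⟨ ifᶜ b then P else Q , s ⟩⇓[ 1 + costᵇ b + t ] s′
  ifFalse : ∀ {b P Q s s′ t} → ⟦ b ⟧ᵇ s ≡ false →
            ⟨ Q , s ⟩⇓[ t ] s′ →
            ⟨ ifᶜ b then P else Q , s ⟩⇓[ 1 + costᵇ b + t ] s′
  done    : ∀ {b P s} → ⟦ b ⟧ᵇ s ≡ false →
            ⟨ while b loop P , s ⟩⇓[ 1 + costᵇ b ] s
  again   : ∀ {b P s s′ s″ t t′} → ⟦ b ⟧ᵇ s ≡ true →
            ⟨ P , s ⟩⇓[ t ] s′ →
            ⟨ while b loop P , s′ ⟩⇓[ t′ ] s″ →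
            ⟨ while b loop P , s ⟩⇓[ 1 + costᵇ b + t + t′ ] s″

------------------------------------------------------------------------
-- Input and output conventions

bit : Bool → ℕ
bit b = if b then 1 else 0

code : Part → ℕ
code A = 0
code B = 1
code C = 2

module _ (G : TripartiteGraph) where
  open TripartiteGraph G

  adjBit : ℕ → ℕ → ℕ
  adjBit i j with i <? n | j <? n
  ... | yes i<n | yes j<n = bit (adj (fromℕ< i<n) (fromℕ< j<n))
  ... | _       | _       = 0

  partCode : ℕ → ℕ
  partCode i with i <? n
  ... | yes i<n = code (part (fromℕ< i<n))
  ... | no  _   = 0

  inputReg : ℕ → ℕ
  inputReg 0       = n
  inputReg (suc _) = 0

  inputArr : ℕ → ℕ → ℕ → ℕ
  inputArr 0 i j = adjBit i j
  inputArr 1 i 0 = partCode i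
  inputArr _ _ _ = 0

  -- Register 0 holds n, array 0 the adjacency matrix, column 0 of array 1 the
  -- part of each vertex; all remaining memory is zero.
  load : Memory
  load = mem inputReg inputArr

-- The memory presents (T , k) as an instance of the (k,m)-king problem:
-- register 1 holds m, register 2 holds k, array 2 the adjacency matrix of T.
record Outputs (s : Memory) {m : ℕ} (T : Tournament m) (k : ℕ) : Set where
  field
    order  : reg s 1 ≡ m
    number : reg s 2 ≡ k
    matrix : ∀ u v → arr s 2 (toℕ u) (toℕ v) ≡ bit (Tournament.edge T u v)

-- The tournament consists of the vertices of G, a copy a′ of each a ∈ A, and two vertices x and y.
-- Arrows a → b and b → c are the edges of G, a′ → c are the non-edges ac, the only arrows from A to
-- the copies are a → a′, and C → A.  So a reaches c in two steps iff ac is a non-edge or lies in a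
-- triangle.  With A, C → x → B, A′, y and B, x → y → A, A′, C and B → A′, each a reaches everything
-- outside C, no copy reaches y, and x, y and all vertices of B and C are kings, provided that B and C
-- carry tournaments consisting of kings.  Hence there are |B| + |C| + 2 kings plus one for each a
-- witnessing a yes-instance.
--
-- Tournaments consisting of kings do not exist on 2 or 4 vertices, but |B|, |C| ≥ δ n leaves only
-- boundedly many n for which B or C is that small.  For these the program searches for a witness and
-- outputs a tournament consisting of kings if there is one, and a transitive tournament otherwise.

module Submission where

open import Defs
open import Data.Bool using (Bool; true; false; not; _∧_; _∨_; _xor_; if_then_else_)
open import Data.Bool.Properties using (T-≡; ∧-conicalˡ; ∧-conicalʳ; ∨-identityʳ)
open import Data.Empty using (⊥; ⊥-elim)
open import Data.Fin using (Fin; toℕ; fromℕ<)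
import Data.Fin.Properties as Finₚ
open import Data.Fin.Subset using (Subset; _∈_; _∉_; _⊆_; ∣_∣; inside; outside)
open import Data.Fin.Subset.Properties using (_∈?_; p⊆q⇒∣p∣≤∣q∣; out⊆; s⊆s; ⊆-refl)
import Data.Integer as ℤ
import Data.Integer.Properties as ℤₚ
open import Data.Nat hiding (parity)
open import Data.Nat.Properties
open import Data.Product using (Σ-syntax; ∃-syntax; _×_; _,_; proj₁; proj₂)
open import Data.Rational as ℚ using (ℚ; 0ℚ; mkℚ; toℚᵘ) renaming (_<_ to _<ℚ_)
import Data.Rational.Properties as ℚₚ
import Data.Rational.Unnormalised as ℚᵘ
import Data.Rational.Unnormalised.Properties as ℚᵘₚ
open import Data.Sum using (_⊎_; inj₁; inj₂)
open import Data.Unit using (⊤)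
open import Data.Vec using (_∷_; []; tabulate)
open import Data.Vec.Properties using (lookup∘tabulate; lookup⇒[]=; []=⇒lookup; tabulate-cong)
open import Function using (_∘_)
open import Function.Bundles using (Equivalence; _⇔_; mk⇔)
open import Relation.Binary.Definitions using (tri<; tri≈; tri>)
open import Relation.Binary.PropositionalEquality
open import Relation.Nullary

-- The tournament is defined by the very test that the program evaluates, applied to the few tables
-- which that test reads. The matrix written by the program is then correct almost by definition,
-- and every statement about kings concerns one Boolean expression.
--
-- The target n - |A| + 3 equals |B| + |C| + 3, one more than the number of kings that are present
-- in any case; hence a single further king decides.
--
-- The threshold is five times the denominator of δ. A positive δ is at least 1 over its
-- denominator, so from there on B and C have at least 5 vertices, and one construction of
-- tournaments consisting of kings serves all sizes from 5 on. That construction depends on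
-- parities, which are tabulated beforehand because the machine can only increment and decrement.
-- The search below the threshold is cubic, but the quadratic bound is claimed only from the
-- threshold on.

≡ᵇ-true : ∀ {m n} → m ≡ n → (m ≡ᵇ n) ≡ true
≡ᵇ-true {m} {n} p = Equivalence.to T-≡ (≡⇒≡ᵇ m n p)

≡ᵇ-true⁻¹ : ∀ {m n} → (m ≡ᵇ n) ≡ true → m ≡ n
≡ᵇ-true⁻¹ {m} {n} p = ≡ᵇ⇒≡ m n (Equivalence.from T-≡ p)

≡ᵇ-false : ∀ {m n} → m ≢ n → (m ≡ᵇ n) ≡ false
≡ᵇ-false {m} {n} m≢n with m ≡ᵇ n in eq
... | true  = ⊥-elim (m≢n (≡ᵇ-true⁻¹ eq))
... | false = refl

<ᵇ-true : ∀ {m n} → m < n → (m <ᵇ n) ≡ true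
<ᵇ-true p = Equivalence.to T-≡ (<⇒<ᵇ p)

<ᵇ-false : ∀ {m n} → n ≤ m → (m <ᵇ n) ≡ false
<ᵇ-false {m} {n} n≤m with m <ᵇ n in eq
... | true  = ⊥-elim (<⇒≱ (<ᵇ⇒< m n (Equivalence.from T-≡ eq)) n≤m)
... | false = refl

absurd : ∀ {b : Bool} {P : Set} → b ≡ true → b ≡ false → P
absurd refl ()

-- Counting below a bound, and subsets of prescribed size.

count : (ℕ → Bool) → ℕ → ℕ
count f zero    = 0
count f (suc n) = bit (f n) + count f n

count-cong : ∀ {f g} n → (∀ i → i < n → f i ≡ g i) → count f n ≡ count g n
count-cong zero    f≗g = refl
count-cong (suc n) f≗g =
  cong₂ (λ b k → bit b + k) (f≗g n ≤-refl) (count-cong n λ i i<n → f≗g i (m≤n⇒m≤1+n i<n))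

count-+ : ∀ f m n → count f (m + n) ≡ count f m + count (λ i → f (m + i)) n
count-+ f m zero    = trans (cong (count f) (+-identityʳ m)) (sym (+-identityʳ _))
count-+ f m (suc n) rewrite +-suc m n | count-+ f m n =
  trans (sym (+-assoc (bit (f (m + n))) (count f m) _))
    (trans (cong (_+ count (λ i → f (m + i)) n) (+-comm (bit (f (m + n))) (count f m)))
      (+-assoc (count f m) _ _))

count-mono : ∀ f {m n} → m ≤ n → count f m ≤ count f n
count-mono f {m} {n} m≤n = subst (λ k → count f m ≤ count f k) (m+[n∸m]≡n m≤n)
  (subst (count f m ≤_) (sym (count-+ f m (n ∸ m))) (m≤m+n _ _))

count-step : ∀ f {m} → f m ≡ true → count f (suc m) ≡ suc (count f m)
count-step f fm rewrite fm = refl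

count-< : ∀ f {m n} → f m ≡ true → m < n → count f m < count f n
count-< f {m} {n} fm m<n =
  subst (_≤ count f n) (count-step f fm) (count-mono f {suc m} {n} m<n)

-- Counts grow by at most one per step, so ranks have no gaps. This turns a rank back into a vertex,
-- both inside a class and among the copies.
count-surj : ∀ f n {r} → r < count f n → ∃[ i ] (i < n × f i ≡ true × count f i ≡ r)
count-surj f (suc n) {r} r< with f n in fn
... | false = let i , i<n , p = count-surj f n r< in i , m≤n⇒m≤1+n i<n , p
... | true with m≤n⇒m<n∨m≡n (s≤s⁻¹ r<)
...   | inj₁ r<c = let i , i<n , p = count-surj f n r<c in i , m≤n⇒m≤1+n i<n , p
...   | inj₂ r≡c = n , ≤-refl , fn , sym r≡c

count-false : ∀ n → count (λ _ → false) n ≡ 0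
count-false zero    = refl
count-false (suc n) = count-false n

count-true : ∀ n → count (λ _ → true) n ≡ n
count-true zero    = refl
count-true (suc n) = cong suc (count-true n)

count-pop : ∀ f n → count f (suc n) ≡ bit (f 0) + count (f ∘ suc) n
count-pop f zero    = refl
count-pop f (suc n) rewrite count-pop f n =
  trans (sym (+-assoc (bit (f (suc n))) (bit (f 0)) _))
    (trans (cong (_+ count (f ∘ suc) n) (+-comm (bit (f (suc n))) (bit (f 0))))
      (+-assoc (bit (f 0)) _ _))

count≤ : ∀ f n → count f n ≤ n
count≤ f zero    = z≤n
count≤ f (suc n) with f n
... | true  = s≤s (count≤ f n)
... | false = m≤n⇒m≤1+n (count≤ f n)

select : ∀ m → (ℕ → Bool) → Subset m
select m f = tabulate (f ∘ toℕ)

∣select∣ : ∀ m f → ∣ select m f ∣ ≡ count f m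
∣select∣ zero    f = refl
∣select∣ (suc m) f rewrite count-pop f m with f 0
... | true  = cong suc (∣select∣ m (f ∘ suc))
... | false = ∣select∣ m (f ∘ suc)

∈-select : ∀ {m} f {v : Fin m} → f (toℕ v) ≡ true → v ∈ select m f
∈-select f {v} p = lookup⇒[]= v _ (trans (lookup∘tabulate _ v) p)

∈-select⁻¹ : ∀ {m} f {v : Fin m} → v ∈ select m f → f (toℕ v) ≡ true
∈-select⁻¹ f {v} p = trans (sym (lookup∘tabulate _ v)) ([]=⇒lookup p)

subset-of-size : ∀ {m} k (p : Subset m) → k ≤ ∣ p ∣ → ∃[ q ] (q ⊆ p × ∣ q ∣ ≡ k)
subset-of-size zero    []            _   = [] , ⊆-refl , refl
subset-of-size k       (outside ∷ p) k≤  =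
  let q , q⊆p , ∣q∣ = subset-of-size k p k≤ in outside ∷ q , out⊆ q⊆p , ∣q∣
subset-of-size zero    (inside ∷ p)  _   =
  let q , q⊆p , ∣q∣ = subset-of-size zero p z≤n in outside ∷ q , out⊆ q⊆p , ∣q∣
subset-of-size (suc k) (inside ∷ p) k≤  =
  let q , q⊆p , ∣q∣ = subset-of-size k p (s≤s⁻¹ k≤) in inside ∷ q , s⊆s q⊆p , cong suc ∣q∣

∃-∉ : ∀ {m} (p q : Subset m) → ∣ q ∣ < ∣ p ∣ → ∃[ v ] (v ∈ p × v ∉ q)
∃-∉ p q ∣q∣<∣p∣ with Finₚ.any? (λ v → (v ∈? p) ×-dec ¬? (v ∈? q))
... | yes w = w
... | no ¬w = ⊥-elim (<⇒≱ ∣q∣<∣p∣ (p⊆q⇒∣p∣≤∣q∣ λ {v} v∈p →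
  decidable-stable (v ∈? q) λ v∉q → ¬w (v , v∈p , v∉q)))

-- Tournaments consisting of kings.

par : ℕ → ℕ
par 0             = 0
par 1             = 1
par (suc (suc n)) = par n

par-cases : ∀ n → (par n ≡ 0 × par (suc n) ≡ 1) ⊎ (par n ≡ 1 × par (suc n) ≡ 0)
par-cases 0             = inj₁ (refl , refl)
par-cases 1             = inj₂ (refl , refl)
par-cases (suc (suc n)) = par-cases n

-- win m r v says whether r → v, for r < v.  The tournament grows from the single vertex 0 by pairs
-- (1 , 2), (3 , 4), ..., where a pair (p , q) is added to K by p → K → q → p.  The last vertex of an
-- even m has no partner; it beats 0 and m ∸ 3 only.
win : ℕ → ℕ → ℕ → Bool
win m r v = not (not ((par v ≡ᵇ 0) ∧ not (suc r ≡ᵇ v)) ∧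
  not ((par v ≡ᵇ 1) ∧ ((suc v ≡ᵇ m) ∧ (not (r ≡ᵇ 0) ∧ not (suc (suc r) ≡ᵇ v)))))

data Beats (m r v : ℕ) : Set where
  up   : r < v → win m r v ≡ true → Beats m r v
  down : v < r → win m v r ≡ false → Beats m r v

private
  01-clash : ∀ {A : Set} {n} → n ≡ 0 → n ≡ 1 → A
  01-clash refl ()

  even-up : ∀ {m r v} → r < v → par v ≡ 0 → suc r ≢ v → Beats m r v
  even-up {m} {r} {v} r<v p q = up r<v lemma
    where
    lemma : win m r v ≡ true
    lemma rewrite p | ≡ᵇ-false q = refl

  even-down : ∀ {m r} → par (suc r) ≡ 0 → Beats m (suc r) r
  even-down {m} {r} p = down ≤-refl lemma
    where
    lemma : win m r (suc r) ≡ false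
    lemma rewrite p | ≡ᵇ-true {suc r} refl = refl

  odd-down : ∀ {m r v} → r < v → par v ≡ 1 → suc v ≢ m → Beats m v r
  odd-down {m} {r} {v} r<v p q = down r<v lemma
    where
    lemma : win m r v ≡ false
    lemma rewrite p | ≡ᵇ-false q = refl

  last-up : ∀ {r v} → r < v → par v ≡ 1 → r ≢ 0 → suc (suc r) ≢ v → Beats (suc v) r v
  last-up {r} {v} r<v p q t = up r<v lemma
    where
    lemma : win (suc v) r v ≡ true
    lemma rewrite p | ≡ᵇ-true {suc v} refl | ≡ᵇ-false q | ≡ᵇ-false t = refl

  last-down₀ : ∀ {v} → 0 < v → par v ≡ 1 → Beats (suc v) v 0
  last-down₀ {v} 0<v p = down 0<v lemma
    where
    lemma : win (suc v) 0 v ≡ false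
    lemma rewrite p | ≡ᵇ-true {suc v} refl = refl

  last-down₂ : ∀ {r} → par r ≡ 1 → Beats (suc (suc (suc r))) (suc (suc r)) r
  last-down₂ {zero}  ()
  last-down₂ {suc r} p = down (s≤s (n≤1+n (suc r))) lemma
    where
    lemma : win (suc (suc (suc (suc r)))) (suc r) (suc (suc (suc r))) ≡ false
    lemma rewrite p | ≡ᵇ-true {r} refl = refl

  par≢0 : ∀ {r} → par r ≡ 1 → r ≢ 0
  par≢0 () refl

  -- The unpaired last vertex beats 0. The detour goes through its predecessor, which is even and so
  -- loses to 0, and which beats the last vertex.
  zero-to-last : ∀ {v} → 4 ≤ v → par v ≡ 1 → let m = suc v in
    Beats m 0 v ⊎ ∃[ w ] (w < m × Beats m 0 w × Beats m w v)
  zero-to-last {suc w} (s≤s 3≤w) odd with par-cases w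
  ... | inj₂ (_ , even) = 01-clash even odd
  ... | inj₁ (even , _) = inj₂ (w , m≤n⇒m≤1+n ≤-refl ,
    even-up (≤-trans (s≤s z≤n) 3≤w) even (λ { refl → <⇒≱ 3≤w (s≤s z≤n) }) ,
    last-up ≤-refl odd (λ { refl → <⇒≱ 3≤w z≤n }) λ p → 1+n≢n (suc-injective p))

-- Detours for arrows that point the wrong way: if `v` is even and `r` is its partner, 0 lies
-- between; if `v` is odd with a partner, that partner `suc v` does. If `v` is the unpaired last
-- vertex, 0 uses `zero-to-last` and `v ∸ 2` goes through 1.
beats-up : ∀ {m r v} → 5 ≤ m → v < m → r < v →
  Beats m r v ⊎ ∃[ w ] (w < m × Beats m r w × Beats m w v)
beats-up {m} {r} {v} 5≤m v<m r<v with par-cases v | suc r ≟ v | suc v ≟ m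
... | inj₁ (even , _) | no  q    | _ = inj₁ (even-up r<v even q)
... | inj₁ (even , _) | yes refl | _ with par-cases r
...   | inj₁ (_ , odd) = 01-clash even odd
...   | inj₂ (odd , _) = inj₂ (0 , ≤-trans (s≤s z≤n) 5≤m ,
  odd-down (n≢0⇒n>0 (par≢0 odd)) odd (<⇒≢ v<m) ,
  even-up (s≤s z≤n) even λ p → par≢0 odd (sym (suc-injective p)))
beats-up {m} {r} {v} 5≤m v<m r<v | inj₂ (_ , even) | _ | no q =
  inj₂ (suc v , ≤∧≢⇒< v<m q ,
    even-up (m≤n⇒m≤1+n r<v) even (<⇒≢ (s≤s r<v)) ,
    even-down even)
beats-up {m} {r} {v} 5≤m v<m r<v | inj₂ (odd , _) | _ | yes refl with r ≟ 0 | suc (suc r) ≟ v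
... | yes refl | _        = zero-to-last (s≤s⁻¹ 5≤m) odd
... | no r≢0   | no  q    = inj₁ (last-up r<v odd r≢0 q)
... | no r≢0   | yes refl = inj₂ (1 , s≤s (s≤s z≤n) ,
  odd-down (s≤s⁻¹ (s≤s⁻¹ (s≤s⁻¹ 5≤m))) odd (<⇒≢ (s≤s (n≤1+n (suc r)))) ,
  -- 1 loses to the last vertex only if that vertex is 3, that is, if `m` is 4, a size without such
  -- a tournament.
  last-up (s≤s (s≤s z≤n)) odd (λ ()) λ { refl → <⇒≱ 5≤m ≤-refl })

-- An even `r` beats its partner, which beats everything below itself; an odd `r` with a partner
-- needs no detour. The unpaired last vertex uses its only two victims: 0 leads to `r ∸ 1`, and the
-- odd `r ∸ 2` leads to everything below itself.
beats-down : ∀ {m r v} → 5 ≤ m → r < m → v < r →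
  Beats m r v ⊎ ∃[ w ] (w < m × Beats m r w × Beats m w v)
beats-down {m} {suc r} {v} 5≤m r<m v<r with par-cases r | suc r ≟ suc v | suc (suc r) ≟ m
... | inj₂ (_ , even)  | yes refl | _ = inj₁ (even-down even)
... | inj₂ (odd , even) | no  q   | _ = inj₂ (r , <-trans ≤-refl r<m ,
  even-down even ,
  odd-down (≤∧≢⇒< (s≤s⁻¹ v<r) λ p → q (cong suc (sym p))) odd (<⇒≢ r<m))
... | inj₁ (_ , odd) | _ | no q = inj₁ (odd-down v<r odd q)
... | inj₁ (even , odd) | yes refl | yes refl = inj₂ (0 , s≤s z≤n ,
  last-down₀ (s≤s z≤n) odd ,
  even-up (≤-trans (s≤s z≤n) (s≤s⁻¹ (s≤s⁻¹ 5≤m))) even λ { refl → <⇒≱ 5≤m (s≤s (s≤s (s≤s z≤n))) })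
beats-down {m} {suc zero} {v} 5≤m r<m v<r | inj₁ (even , odd) | no q | yes refl =
  ⊥-elim (q (cong suc (sym (n<1⇒n≡0 v<r))))
beats-down {m} {suc (suc w)} {v} 5≤m r<m v<r | inj₁ (even , odd) | no q | yes refl with v ≟ w
... | yes refl = inj₁ (last-down₂ odd)
... | no v≢w   = inj₂ (w , s≤s (m≤n⇒m≤1+n (n≤1+n w)) ,
  last-down₂ odd ,
  odd-down (≤∧≢⇒< (s≤s⁻¹ (≤∧≢⇒< (s≤s⁻¹ v<r) λ p → q (cong suc (sym p)))) v≢w) odd
    (<⇒≢ (s≤s (s≤s (n≤1+n w)))))

beats-all : ∀ {m} → 5 ≤ m → ∀ {r v} → r < m → v < m → r ≢ v →
  Beats m r v ⊎ ∃[ w ] (w < m × Beats m r w × Beats m w v)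
beats-all 5≤m {r} {v} r<m v<m r≢v with <-cmp r v
... | tri< r<v _ _ = beats-up 5≤m v<m r<v
... | tri≈ _ r≡v _ = ⊥-elim (r≢v r≡v)
... | tri> _ _ v<r = beats-down 5≤m r<m v<r

-- Running programs: total correctness with time bounds.

Run : Cmd → Memory → ℕ → (Memory → Set) → Set
Run P s τ Q = Σ[ s′ ∈ Memory ] Σ[ t ∈ ℕ ] (⟨ P , s ⟩⇓[ t ] s′ × t ≤ τ × Q s′)

Straight : Cmd → Set
Straight skip                     = ⊤
Straight (x := e)                 = ⊤
Straight (put a e f g)            = ⊤
Straight (P ⨾ Q)                  = Straight P × Straight Q
Straight (ifᶜ t then P else Q)    = Straight P × Straight Q
Straight (while t loop P)         = ⊥

-- Junk on loops, here and in time.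
exec : Cmd → Memory → Memory
exec skip s                  = s
exec (x := e) s              = setReg x (⟦ e ⟧ s) s
exec (put a e f g) s         = setArr a (⟦ e ⟧ s) (⟦ f ⟧ s) (⟦ g ⟧ s) s
exec (P ⨾ Q) s               = exec Q (exec P s)
exec (ifᶜ t then P else Q) s = if ⟦ t ⟧ᵇ s then exec P s else exec Q s
exec (while t loop P) s      = s

time : Cmd → ℕ
time skip                  = 1
time (x := e)              = 1 + cost e
time (put a e f g)         = 1 + (cost e + cost f + cost g)
time (P ⨾ Q)               = time P + time Q
-- The sum of the two branches bounds either one, so that the bound depends on the program alone.
time (ifᶜ t then P else Q) = 1 + costᵇ t + (time P + time Q)
time (while t loop P)      = 0

run-straight : ∀ P {s} {Q : Memory → Set} → Straight P → Q (exec P s) → Run P s (time P) Q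
run-straight P {s} {Q} P-straight q = let t , ⇓ , t≤ = go P s P-straight in exec P s , t , ⇓ , t≤ , q
  where
  go : ∀ P s → Straight P → Σ[ t ∈ ℕ ] (⟨ P , s ⟩⇓[ t ] exec P s × t ≤ time P)
  go skip          s _ = _ , skip , ≤-refl
  go (x := e)      s _ = _ , assign , ≤-refl
  go (put a e f g) s _ = _ , store , ≤-refl
  go (P ⨾ Q)       s (p , q) =
    let _ , ⇓₁ , t₁≤ = go P s p ; _ , ⇓₂ , t₂≤ = go Q (exec P s) q
    in _ , seq ⇓₁ ⇓₂ , +-mono-≤ t₁≤ t₂≤
  go (ifᶜ t then P else Q) s (p , q) with ⟦ t ⟧ᵇ s in eq
  ... | true  = let _ , ⇓ , t≤ = go P s p in
    _ , ifTrue eq ⇓ , +-monoʳ-≤ (1 + costᵇ t) (m≤n⇒m≤n+o (time Q) t≤)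
  ... | false = let _ , ⇓ , t≤ = go Q s q in
    _ , ifFalse eq ⇓ , +-monoʳ-≤ (1 + costᵇ t) (m≤n⇒m≤o+n (time P) t≤)

run-⨾ : ∀ {P P′ s τ τ′} {Q R : Memory → Set} → Run P s τ Q →
  (∀ {s′} → Q s′ → Run P′ s′ τ′ R) → Run (P ⨾ P′) s (τ + τ′) R
run-⨾ (s′ , t , ⇓ , t≤ , q) k = let s″ , t′ , ⇓′ , t′≤ , r = k q in
  s″ , t + t′ , seq ⇓ ⇓′ , +-mono-≤ t≤ t′≤ , r

run-weaken : ∀ {P s τ} {Q R : Memory → Set} → (∀ {s′} → Q s′ → R s′) → Run P s τ Q → Run P s τ R
run-weaken f (s′ , t , ⇓ , t≤ , q) = s′ , t , ⇓ , t≤ , f q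

run-if-true : ∀ {b P P′ s τ} {Q : Memory → Set} → ⟦ b ⟧ᵇ s ≡ true →
  Run P s τ Q → Run (ifᶜ b then P else P′) s (1 + costᵇ b + τ) Q
run-if-true p (s′ , t , ⇓ , t≤ , q) = s′ , _ , ifTrue p ⇓ , s≤s (+-monoʳ-≤ _ t≤) , q

run-if-false : ∀ {b P P′ s τ} {Q : Memory → Set} → ⟦ b ⟧ᵇ s ≡ false →
  Run P′ s τ Q → Run (ifᶜ b then P else P′) s (1 + costᵇ b + τ) Q
run-if-false p (s′ , t , ⇓ , t≤ , q) = s′ , _ , ifFalse p ⇓ , s≤s (+-monoʳ-≤ _ t≤) , q

upto : ℕ → ℕ → Cmd → Cmd
upto r l P = while var r << var l loop P

-- The invariant determines counter and limit, so the test first fails after `N` rounds. Each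
-- evaluation of the test costs 4; the final 4 pays for the one that ends the loop.
run-upto : ∀ {r l P N τ} (I : ℕ → Memory → Set) →
  (∀ {i s} → I i s → reg s r ≡ i) → (∀ {i s} → I i s → reg s l ≡ N) →
  (∀ {i s} → i < N → I i s → Run P s τ (I (suc i))) →
  ∀ {s} → I 0 s → Run (upto r l P) s (N * (4 + τ) + 4) (I N)
run-upto {r} {l} {P} {N} {τ} I counter limit body {s} I₀ = go N 0 (+-identityʳ N) I₀
  where
  go : ∀ k i {s} → k + i ≡ N → I i s → Run (upto r l P) s (k * (4 + τ) + 4) (I N)
  go zero    i {s} refl Iᵢ = s , _ , done stop , ≤-refl , Iᵢ
    where
    stop : (reg s r <ᵇ reg s l) ≡ false
    stop = <ᵇ-false (≤-reflexive (trans (limit Iᵢ) (sym (counter Iᵢ))))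
  go (suc k) i {s} k+i Iᵢ =
    let i<N = subst (i <_) k+i (s≤s (m≤n+m i k))
        s₁ , t₁ , ⇓₁ , t₁≤ , I₁ = body i<N Iᵢ
        s₂ , t₂ , ⇓₂ , t₂≤ , I₂ = go k (suc i) (trans (+-suc k i) k+i) I₁
        more = <ᵇ-true (subst₂ _<_ (sym (counter Iᵢ)) (sym (limit Iᵢ)) i<N)
    in s₂ , _ , again more ⇓₁ ⇓₂ ,
       subst (4 + t₁ + t₂ ≤_) (sym (+-assoc (4 + τ) (k * (4 + τ)) 4))
         (+-mono-≤ (+-monoʳ-≤ 4 t₁≤) t₂≤) , I₂

-- The arrow test and the tournament that it defines.

infixr 7 _or_

_or_ : Test → Test → Test
t or u = neg (neg t and neg u)

-- Column 0 of the arrays 1, 3, 4 holds the kind of each vertex, the original of a copy (vertices of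
-- G being their own originals), and the number of earlier vertices of the same kind.  Column 0 of
-- the array 5 holds the parities of the naturals, that of the array 8 the size of each kind.
-- Register 9 is 1 when the vertices of equal kind are to form a transitive tournament.
kind orig rank : ℕ → Exp
kind x = get 1 (var x) (lit 0)
orig x = get 3 (var x) (lit 0)
rank x = get 4 (var x) (lit 0)

adjacent : ℕ → ℕ → Test
adjacent x y = get 0 (orig x) (orig y) == lit 1

between : ℕ → ℕ → ℕ → ℕ → Test
between x i y j = kind x == lit i and kind y == lit j

-- The kinds are 0, 1, 2 for A, B, C, then 3 for the copies of the vertices of A, and 4, 5 for the
-- two extra vertices.
cross : ℕ → ℕ → Test
cross x y =
  (between x 0 y 1 and adjacent x y) or (between x 0 y 3 and orig x == orig y) or
  between x 0 y 4 or
  (between x 1 y 2 and adjacent x y) or between x 1 y 3 or between x 1 y 5 or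
  (between x 2 y 3 and adjacent x y) or between x 2 y 4 or
  between x 4 y 5

parityᴱ : ℕ → Exp
parityᴱ x = get 5 (rank x) (lit 0)

-- With flag 0 this is `win` in terms of ranks, with the same nesting of negations so that the two
-- agree by computation. With flag 1 it is constantly false, and every arrow points to the smaller
-- index.
inner : ℕ → ℕ → Test
inner x y = var 9 == lit 0 and
  ((parityᴱ y == lit 0 and neg (inc (rank x) == rank y)) or
   (parityᴱ y == lit 1 and inc (rank y) == get 8 (kind y) (lit 0) and
    neg (rank x == lit 0) and neg (inc (inc (rank x)) == rank y)))

-- Every pair is judged in one order only, by kind and then by index, and the opposite order
-- receives the negation. Hence any tables whatever yield a tournament.
arrow : Test
arrow =
  (kind 7 << kind 8 and cross 7 8) or
  (kind 8 << kind 7 and neg (cross 8 7)) or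
  (kind 7 == kind 8 and ((var 7 << var 8 and inner 7 8) or (var 8 << var 7 and neg (inner 8 7))))

-- All that `arrow` reads apart from the pair of vertices. Writing to array 2 leaves it unchanged,
-- so the tournament stays fixed while its matrix is produced.
record Tables : Set where
  field
    ad          : ℕ → ℕ → ℕ
    kd og rk pr mk : ℕ → ℕ
    fl          : ℕ

tables : Memory → Tables
tables s = record
  { ad = arr s 0
  ; kd = λ i → arr s 1 i 0 ; og = λ i → arr s 3 i 0 ; rk = λ i → arr s 4 i 0
  ; pr = λ i → arr s 5 i 0 ; mk = λ i → arr s 8 i 0 ; fl = reg s 9 }

memory : Tables → ℕ → ℕ → Memory
memory D u v = mem
  (λ { 7 → u ; 8 → v ; 9 → fl ; _ → 0 })
  (λ { 0 i j → ad i j ; 1 i _ → kd i ; 3 i _ → og i ; 4 i _ → rk i ; 5 i _ → pr i ; 8 i _ → mk i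
     ; _ _ _ → 0 })
  where open Tables D

-- Opaque so that D, u and v can be inferred from an edge.
opaque
  edgeOf : Tables → ℕ → ℕ → Bool
  edgeOf D u v = ⟦ arrow ⟧ᵇ (memory D u v)

  arrow-edge : ∀ s → ⟦ arrow ⟧ᵇ s ≡ edgeOf (tables s) (reg s 7) (reg s 8)
  arrow-edge s = refl

fillCell fillRow fill : Cmd
fillCell =
  (ifᶜ arrow then put 2 (var 7) (var 8) (lit 1) else put 2 (var 7) (var 8) (lit 0)) ⨾
  8 := inc (var 8)
fillRow = 8 := lit 0 ⨾ upto 8 1 fillCell ⨾ 7 := inc (var 7)
fill = 7 := lit 0 ⨾ upto 7 1 fillRow

xor-notʳ : ∀ b → b xor not b ≡ true
xor-notʳ true  = refl
xor-notʳ false = refl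

xor-notˡ : ∀ b → not b xor b ≡ true
xor-notˡ true  = refl
xor-notˡ false = refl

module _ (D : Tables) where
  open Tables D

  cross-edge inner-edge : ℕ → ℕ → Bool
  cross-edge u v = ⟦ cross 7 8 ⟧ᵇ (memory D u v)
  inner-edge u v = ⟦ inner 7 8 ⟧ᵇ (memory D u v)

  opaque
    unfolding edgeOf

    edge-lower : ∀ {u v} → kd u < kd v → edgeOf D u v ≡ cross-edge u v
    edge-lower {u} {v} p
      rewrite <ᵇ-true p | <ᵇ-false (<⇒≤ p) | ≡ᵇ-false (<⇒≢ p) with cross-edge u v
    ... | true  = refl
    ... | false = refl

    edge-upper : ∀ {u v} → kd v < kd u → edgeOf D u v ≡ not (cross-edge v u)
    edge-upper {u} {v} p
      rewrite <ᵇ-true p | <ᵇ-false (<⇒≤ p) | ≡ᵇ-false (≢-sym (<⇒≢ p)) with cross-edge v u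
    ... | true  = refl
    ... | false = refl

    edge-same-< : ∀ {u v} → kd u ≡ kd v → u < v → edgeOf D u v ≡ inner-edge u v
    edge-same-< {u} {v} p q
      rewrite <ᵇ-true q | <ᵇ-false (<⇒≤ q) | <ᵇ-false (≤-reflexive p)
            | <ᵇ-false (≤-reflexive (sym p)) | ≡ᵇ-true p with inner-edge u v
    ... | true  = refl
    ... | false = refl

    edge-same-> : ∀ {u v} → kd u ≡ kd v → v < u → edgeOf D u v ≡ not (inner-edge v u)
    edge-same-> {u} {v} p q
      rewrite <ᵇ-true q | <ᵇ-false (<⇒≤ q) | <ᵇ-false (≤-reflexive p)
            | <ᵇ-false (≤-reflexive (sym p)) | ≡ᵇ-true p with inner-edge v u
    ... | true  = refl
    ... | false = refl

    edge-refl : ∀ u → edgeOf D u u ≡ false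
    edge-refl u rewrite <ᵇ-false (≤-refl {kd u}) | <ᵇ-false (≤-refl {u}) | ≡ᵇ-true {kd u} refl = refl

  edge-oneWay : ∀ u v → u ≢ v → edgeOf D u v xor edgeOf D v u ≡ true
  edge-oneWay u v u≢v with <-cmp (kd u) (kd v) | <-cmp u v
  ... | tri< p _ _ | _          =
    trans (cong₂ _xor_ (edge-lower p) (edge-upper p)) (xor-notʳ (cross-edge u v))
  ... | tri> _ _ p | _          =
    trans (cong₂ _xor_ (edge-upper p) (edge-lower p)) (xor-notˡ (cross-edge v u))
  ... | tri≈ _ p _ | tri< q _ _ =
    trans (cong₂ _xor_ (edge-same-< p q) (edge-same-> (sym p) q)) (xor-notʳ (inner-edge u v))
  ... | tri≈ _ p _ | tri≈ _ q _ = ⊥-elim (u≢v q)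
  ... | tri≈ _ p _ | tri> _ _ q =
    trans (cong₂ _xor_ (edge-same-> p q) (edge-same-< (sym p) q)) (xor-notˡ (inner-edge v u))

tournament : ∀ {m} → Tables → Tournament m
tournament D = record
  { edge   = λ u v → edgeOf D (toℕ u) (toℕ v)
  ; irrefl = λ v → edge-refl D (toℕ v)
  ; oneWay = λ u v u≢v → edge-oneWay D (toℕ u) (toℕ v) (u≢v ∘ Finₚ.toℕ-injective)
  }

-- Writing the adjacency matrix.

record Filled (D : Tables) (m k i j : ℕ) (s : Memory) : Set where
  field
    limit  : reg s 1 ≡ m
    result : reg s 2 ≡ k
    row    : reg s 7 ≡ i
    data≡  : tables s ≡ D
    above  : ∀ {u v} → u < i → v < m → arr s 2 u v ≡ bit (edgeOf D u v)
    column : ∀ {v} → v < j → arr s 2 i v ≡ bit (edgeOf D i v)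

setArr-same : ∀ a i j k s → arr (setArr a i j k s) a i j ≡ k
setArr-same a i j k s rewrite ≡ᵇ-true {a} refl | ≡ᵇ-true {i} refl | ≡ᵇ-true {j} refl = refl

setArr-row : ∀ {a i j k s i′ j′} → i′ ≢ i → arr (setArr a i j k s) a i′ j′ ≡ arr s a i′ j′
setArr-row {a} i′≢i rewrite ≡ᵇ-true {a} refl | ≡ᵇ-false i′≢i = refl

setArr-column : ∀ {a i j k s i′ j′} → j′ ≢ j → arr (setArr a i j k s) a i′ j′ ≡ arr s a i′ j′
setArr-column {a} {i} {i′ = i′} j′≢j
  rewrite ≡ᵇ-true {a} refl | ≡ᵇ-false j′≢j with i′ ≡ᵇ i
... | true  = refl
... | false = refl

-- Both branches store a bit in the same cell, so the conditional collapses to one store, whose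
-- value `arrow-edge` identifies.
fillCell-exec : ∀ s → exec fillCell s ≡
  setReg 8 (suc (reg s 8))
    (setArr 2 (reg s 7) (reg s 8) (bit (edgeOf (tables s) (reg s 7) (reg s 8))) s)
fillCell-exec s rewrite sym (arrow-edge s) with ⟦ arrow ⟧ᵇ s
... | true  = refl
... | false = refl

module _ {D : Tables} {m k : ℕ} where
  fillCell-fills : ∀ {i j s} → Filled D m k i j s → reg s 8 ≡ j →
    Filled D m k i (suc j) (exec fillCell s) × reg (exec fillCell s) 8 ≡ suc j
  fillCell-fills {s = s} F refl with Filled.row F | Filled.data≡ F
  ... | refl | refl =
    subst (λ s′ → Filled D m k (reg s 7) (suc (reg s 8)) s′ × reg s′ 8 ≡ suc (reg s 8))
      (sym (fillCell-exec s)) (record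
      { limit  = limit
      ; result = result
      ; row    = refl
      ; data≡  = refl
      ; above  = λ {u} {v} u<i v<m → trans (setArr-row {2} {s = s} (<⇒≢ u<i)) (above u<i v<m)
      ; column = λ {v} v≤j → col (m≤n⇒m<n∨m≡n (s≤s⁻¹ v≤j))
      } , refl)
    where
    open Filled F
    col : ∀ {v} → v < reg s 8 ⊎ v ≡ reg s 8 →
      arr (setArr 2 (reg s 7) (reg s 8) (bit (edgeOf (tables s) (reg s 7) (reg s 8))) s) 2 (reg s 7) v ≡
      bit (edgeOf (tables s) (reg s 7) v)
    col (inj₁ v<j)  = trans (setArr-column {2} {s = s} (<⇒≢ v<j)) (column v<j)
    col (inj₂ refl) = setArr-same 2 (reg s 7) (reg s 8) _ s

  fillRow-runs : ∀ {i s} → Filled D m k i 0 s →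
    Run fillRow s (2 + (m * (4 + time fillCell) + 4 + 3)) (Filled D m k (suc i) 0)
  fillRow-runs {i} F =
    run-⨾ {Q = I 0} (run-straight (8 := lit 0) _ (record { Filled F } , refl)) λ start →
    run-⨾ (run-upto I proj₂ (Filled.limit ∘ proj₁)
      (λ _ (G , p) → run-straight fillCell _ (fillCell-fills G p)) start) λ (G , _) →
    run-straight (7 := inc (var 7)) _ (finish G)
    where
    I : ℕ → Memory → Set
    I j s = Filled D m k i j s × reg s 8 ≡ j

    finish : ∀ {s} → Filled D m k i m s → Filled D m k (suc i) 0 (exec (7 := inc (var 7)) s)
    finish {s} G = record
      { limit  = limit
      ; result = result
      ; row    = cong suc row
      ; data≡  = data≡
      ; above  = λ {u} {v} u≤i v<m → rows v<m (m≤n⇒m<n∨m≡n (s≤s⁻¹ u≤i))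
      ; column = λ ()
      }
      where
      open Filled G
      rows : ∀ {u v} → v < m → _ → arr s 2 u v ≡ bit (edgeOf D u v)
      rows v<m (inj₁ u<i)  = above u<i v<m
      rows v<m (inj₂ refl) = column v<m

  fill-runs : ∀ {s} → reg s 1 ≡ m → reg s 2 ≡ k → tables s ≡ D →
    Run fill s (2 + (m * (4 + (2 + (m * (4 + time fillCell) + 4 + 3))) + 4)) λ s′ →
      reg s′ 1 ≡ m × reg s′ 2 ≡ k ×
      (∀ u v → u < m → v < m → arr s′ 2 u v ≡ bit (edgeOf D u v))
  fill-runs p q r =
    run-⨾ {Q = Filled D m k 0 0} (run-straight (7 := lit 0) _ record
      { limit = p ; result = q ; row = refl ; data≡ = r ; above = λ () ; column = λ () }) λ start →
    run-weaken (λ F → Filled.limit F , Filled.result F , λ u v → Filled.above F)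
      (run-upto (λ i s → Filled D m k i 0 s) Filled.row Filled.limit (λ _ → fillRow-runs) start)

-- Kings as reachability between natural numbers.

module _ (D : Tables) (m : ℕ) where
  infix 4 _⟶_

  _⟶_ : ℕ → ℕ → Set
  u ⟶ v = edgeOf D u v ≡ true

  Reach : ℕ → ℕ → Set
  Reach u v = u ⟶ v ⊎ ∃[ w ] (w < m × u ⟶ w × w ⟶ v)

  Kingly : ℕ → Set
  Kingly v = ∀ {u} → u < m → u ≢ v → Reach v u

module _ {D : Tables} {m : ℕ} where
  private T = tournament {m} D

  king : ∀ {v : Fin m} → Kingly D m (toℕ v) → King T v
  king {v} reach u u≢v with reach (Finₚ.toℕ<n u) (u≢v ∘ Finₚ.toℕ-injective)
  ... | inj₁ e = 1 , s≤s z≤n , step e here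
  ... | inj₂ (w , w<m , e , e′) = 2 , ≤-refl ,
    step {v = fromℕ< w<m} (subst (λ k → edgeOf D (toℕ v) k ≡ true) (sym (Finₚ.toℕ-fromℕ< w<m)) e)
      (step (subst (λ k → edgeOf D k (toℕ u) ≡ true) (sym (Finₚ.toℕ-fromℕ< w<m)) e′) here)

  kingly : ∀ {v : Fin m} → King T v → Kingly D m (toℕ v)
  kingly {v} v-king {u} u<m u≢v = subst (Reach D m (toℕ v)) (Finₚ.toℕ-fromℕ< u<m)
    (reach (v-king (fromℕ< u<m) λ p → u≢v (trans (sym (Finₚ.toℕ-fromℕ< u<m)) (cong toℕ p)))
      λ p → u≢v (trans (sym (Finₚ.toℕ-fromℕ< u<m)) (cong toℕ p)))
    where
    reach : ∀ {u} → ∃[ ℓ ] (ℓ ≤ 2 × Path T v u ℓ) → u ≢ v → Reach D m (toℕ v) (toℕ u)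
    reach (0 , _ , here) u≢v = ⊥-elim (u≢v refl)
    reach (1 , _ , step e here) _ = inj₁ e
    reach (2 , _ , step {v = w} e (step e′ here)) _ = inj₂ (toℕ w , Finₚ.toℕ<n w , e , e′)
    reach (suc (suc (suc _)) , s≤s (s≤s ()) , _) _

  has-kings : ∀ {k} f → (∀ {v} → v < m → f v ≡ true → Kingly D m v) → k ≤ count f m → HasKings T k
  has-kings {k} f f-king k≤ =
    let S , S⊆ , ∣S∣ = subset-of-size k (select m f) (subst (k ≤_) (sym (∣select∣ m f)) k≤)
    in S , ∣S∣ , λ {v} v∈S → king (f-king (Finₚ.toℕ<n v) (∈-select⁻¹ f (S⊆ v∈S)))

  -- Pigeonhole: `k` kings do not fit into fewer than `k` vertices.
  another-king : ∀ {k} f → HasKings T k → count f m < k →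
    ∃[ v ] (v < m × f v ≡ false × Kingly D m v)
  another-king {k} f (S , ∣S∣ , S-kings) < with ∃-∉ S (select m f)
    (subst₂ _<_ (sym (∣select∣ m f)) (sym ∣S∣) <)
  ... | v , v∈S , v∉ with f (toℕ v) in fv
  ...   | true  = ⊥-elim (v∉ (∈-select f fv))
  ...   | false = toℕ v , Finₚ.toℕ<n v , fv , kingly (S-kings v∈S)

-- Arrows between two kinds and inside one kind.

module _ {D : Tables} where
  open Tables D

  private
    Edge : ℕ → ℕ → Bool → Set
    Edge u v e = edgeOf D u v ≡ e

    of-cross : ∀ {u v e} i j → i < j → kd u ≡ i → kd v ≡ j →
      cross-edge D u v ≡ e → Edge u v e × Edge v u (not e)
    of-cross i j i<j refl refl refl = edge-lower D i<j , edge-upper D i<j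

  module _ {u v : ℕ} where
    edge-AB : kd u ≡ 0 → kd v ≡ 1 → let e = ad (og u) (og v) ≡ᵇ 1 in Edge u v e × Edge v u (not e)
    edge-AB p q = of-cross 0 1 (s≤s z≤n) p q lemma
      where
      lemma : cross-edge D u v ≡ (ad (og u) (og v) ≡ᵇ 1)
      lemma rewrite p | q with ad (og u) (og v) ≡ᵇ 1
      ... | true  = refl
      ... | false = refl

    edge-BC : kd u ≡ 1 → kd v ≡ 2 → let e = ad (og u) (og v) ≡ᵇ 1 in Edge u v e × Edge v u (not e)
    edge-BC p q = of-cross 1 2 (s≤s (s≤s z≤n)) p q lemma
      where
      lemma : cross-edge D u v ≡ (ad (og u) (og v) ≡ᵇ 1)
      lemma rewrite p | q with ad (og u) (og v) ≡ᵇ 1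
      ... | true  = refl
      ... | false = refl

    edge-CA′ : kd u ≡ 2 → kd v ≡ 3 → let e = ad (og u) (og v) ≡ᵇ 1 in Edge u v e × Edge v u (not e)
    edge-CA′ p q = of-cross 2 3 (s≤s (s≤s (s≤s z≤n))) p q lemma
      where
      lemma : cross-edge D u v ≡ (ad (og u) (og v) ≡ᵇ 1)
      lemma rewrite p | q with ad (og u) (og v) ≡ᵇ 1
      ... | true  = refl
      ... | false = refl

    edge-AA′ : kd u ≡ 0 → kd v ≡ 3 → let e = og u ≡ᵇ og v in Edge u v e × Edge v u (not e)
    edge-AA′ p q = of-cross 0 3 (s≤s z≤n) p q lemma
      where
      lemma : cross-edge D u v ≡ (og u ≡ᵇ og v)
      lemma rewrite p | q with og u ≡ᵇ og v
      ... | true  = refl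
      ... | false = refl

    edge-AC : kd u ≡ 0 → kd v ≡ 2 → Edge u v false × Edge v u true
    edge-AC p q = of-cross 0 2 (s≤s z≤n) p q lemma
      where
      lemma : cross-edge D u v ≡ false
      lemma rewrite p | q = refl

    edge-Ax : kd u ≡ 0 → kd v ≡ 4 → Edge u v true × Edge v u false
    edge-Ax p q = of-cross 0 4 (s≤s z≤n) p q lemma
      where
      lemma : cross-edge D u v ≡ true
      lemma rewrite p | q = refl

    edge-Ay : kd u ≡ 0 → kd v ≡ 5 → Edge u v false × Edge v u true
    edge-Ay p q = of-cross 0 5 (s≤s z≤n) p q lemma
      where
      lemma : cross-edge D u v ≡ false
      lemma rewrite p | q = refl

    edge-BA′ : kd u ≡ 1 → kd v ≡ 3 → Edge u v true × Edge v u false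
    edge-BA′ p q = of-cross 1 3 (s≤s (s≤s z≤n)) p q lemma
      where
      lemma : cross-edge D u v ≡ true
      lemma rewrite p | q = refl

    edge-Bx : kd u ≡ 1 → kd v ≡ 4 → Edge u v false × Edge v u true
    edge-Bx p q = of-cross 1 4 (s≤s (s≤s z≤n)) p q lemma
      where
      lemma : cross-edge D u v ≡ false
      lemma rewrite p | q = refl

    edge-By : kd u ≡ 1 → kd v ≡ 5 → Edge u v true × Edge v u false
    edge-By p q = of-cross 1 5 (s≤s (s≤s z≤n)) p q lemma
      where
      lemma : cross-edge D u v ≡ true
      lemma rewrite p | q = refl

    edge-Cx : kd u ≡ 2 → kd v ≡ 4 → Edge u v true × Edge v u false
    edge-Cx p q = of-cross 2 4 (s≤s (s≤s (s≤s z≤n))) p q lemma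
      where
      lemma : cross-edge D u v ≡ true
      lemma rewrite p | q = refl

    edge-Cy : kd u ≡ 2 → kd v ≡ 5 → Edge u v false × Edge v u true
    edge-Cy p q = of-cross 2 5 (s≤s (s≤s (s≤s z≤n))) p q lemma
      where
      lemma : cross-edge D u v ≡ false
      lemma rewrite p | q = refl

    edge-A′x : kd u ≡ 3 → kd v ≡ 4 → Edge u v false × Edge v u true
    edge-A′x p q = of-cross 3 4 ≤-refl p q lemma
      where
      lemma : cross-edge D u v ≡ false
      lemma rewrite p = refl

    edge-A′y : kd u ≡ 3 → kd v ≡ 5 → Edge u v false × Edge v u true
    edge-A′y p q = of-cross 3 5 (s≤s (s≤s (s≤s (s≤s z≤n)))) p q lemma
      where
      lemma : cross-edge D u v ≡ false
      lemma rewrite p = refl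

    edge-xy : kd u ≡ 4 → kd v ≡ 5 → Edge u v true × Edge v u false
    edge-xy p q = of-cross 4 5 ≤-refl p q lemma
      where
      lemma : cross-edge D u v ≡ true
      lemma rewrite p | q = refl

  -- `arrow` orders a pair by index and `Beats` orders it by rank, which the two implications
  -- reconcile. After that `inner` and `win` agree by computation.
  beats-edge : ∀ {u v m} → fl ≡ 0 → kd u ≡ kd v → mk (kd u) ≡ m →
    (rk u < rk v → u < v) → (rk v < rk u → v < u) →
    pr (rk u) ≡ par (rk u) → pr (rk v) ≡ par (rk v) →
    Beats m (rk u) (rk v) → Edge u v true
  beats-edge {u} {v} {m} f k refl <→ >→ pu pv (up r w) =
    trans (edge-same-< D k (<→ r)) (trans lemma w)
    where
    lemma : inner-edge D u v ≡ win m (rk u) (rk v)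
    lemma rewrite f | pv | k = refl
  beats-edge {u} {v} {m} f k refl <→ >→ pu pv (down r w) =
    trans (edge-same-> D k (>→ r)) (cong not (trans lemma w))
    where
    lemma : inner-edge D v u ≡ win m (rk v) (rk u)
    lemma rewrite f | pu = refl

-- The kings of the constructed tournament.

record Graph (n : ℕ) (κ : ℕ → ℕ) (α : ℕ → ℕ → ℕ) : Set where
  field
    κ<3        : ∀ {v} → v < n → κ v < 3
    symmetric  : ∀ u v → α u v ≡ α v u
    neighbour  : ∀ {v} k → v < n → k < 3 → k ≢ κ v → ∃[ u ] (u < n × κ u ≡ k × α v u ≡ 1)

countKind : (ℕ → ℕ) → ℕ → ℕ → ℕ
countKind κ k = count λ i → κ i ≡ᵇ k

Good : ℕ → (ℕ → ℕ) → (ℕ → ℕ → ℕ) → ℕ → Set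
Good n κ α a = ∀ {c} → c < n → κ c ≡ 2 → α a c ≡ 1 →
  ∃[ b ] (b < n × κ b ≡ 1 × α a b ≡ 1 × α b c ≡ 1)

-- The vertices of the graph keep their numbers, the copies follow in the order of their originals,
-- then come x at `top` and y. A copy is therefore addressed by `n` plus the rank of its original in
-- A.
record Layout (n : ℕ) (κ : ℕ → ℕ) (α : ℕ → ℕ → ℕ) (D : Tables) : Set where
  open Tables D
  top = n + countKind κ 0 n
  field
    kd-old  : ∀ {i} → i < n → kd i ≡ κ i
    og-old  : ∀ {i} → i < n → og i ≡ i
    rk-old  : ∀ {i} → i < n → rk i ≡ countKind κ (κ i) i
    kd-copy : ∀ {i} → i < n → κ i ≡ 0 → kd (n + countKind κ 0 i) ≡ 3
    og-copy : ∀ {i} → i < n → κ i ≡ 0 → og (n + countKind κ 0 i) ≡ i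
    kd-x    : kd top ≡ 4
    kd-y    : kd (suc top) ≡ 5
    mk-size : ∀ k → mk k ≡ countKind κ k n
    ad-α    : ∀ u v → ad u v ≡ α u v
    fl-0    : fl ≡ 0

count-insert : ∀ f {a} m → f a ≡ false → a < m → count (λ v → f v ∨ (v ≡ᵇ a)) m ≡ suc (count f m)
count-insert f {a} (suc m) fa a<1+m with m≤n⇒m<n∨m≡n (s≤s⁻¹ a<1+m)
... | inj₁ a<m rewrite ≡ᵇ-false (≢-sym (<⇒≢ a<m)) | ∨-identityʳ (f m) | count-insert f m fa a<m =
  +-suc (bit (f m)) (count f m)
... | inj₂ refl rewrite fa | ≡ᵇ-true {a} refl = cong suc (count-cong a same)
  where
  same : ∀ i → i < a → f i ∨ (i ≡ᵇ a) ≡ f i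
  same i i<a rewrite ≡ᵇ-false (<⇒≢ i<a) = ∨-identityʳ (f i)

alwaysKing : ℕ → Bool
alwaysKing 1 = true
alwaysKing 2 = true
alwaysKing 4 = true
alwaysKing 5 = true
alwaysKing _ = false

count-alwaysKing : ∀ κ n → (∀ {i} → i < n → κ i < 3) →
  count (alwaysKing ∘ κ) n ≡ countKind κ 1 n + countKind κ 2 n
count-alwaysKing κ zero    _   = refl
count-alwaysKing κ (suc n) κ<3 rewrite count-alwaysKing κ n (λ i<n → κ<3 (m≤n⇒m≤1+n i<n))
  with κ n | κ<3 {n} ≤-refl
... | 0 | _ = refl
... | 1 | _ = refl
... | 2 | _ = sym (+-suc _ _)
... | suc (suc (suc _)) | s≤s (s≤s (s≤s ()))

module Main {n : ℕ} {κ : ℕ → ℕ} {α : ℕ → ℕ → ℕ} {D : Tables}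
  (G : Graph n κ α) (L : Layout n κ α D)
  (pr-par : ∀ {i} → i < n → Tables.pr D i ≡ par i) (0<n : 0 < n)
  (5≤B : 5 ≤ countKind κ 1 n) (5≤C : 5 ≤ countKind κ 2 n) where

  open Graph G
  open Layout L
  open Tables D

  m = top + 2

  infix 4 _⇒_
  _⇒_ = _⟶_ D m

  data Vertex : ℕ → Set where
    a : ∀ {v} → v < n → κ v ≡ 0 → Vertex v
    b : ∀ {v} → v < n → κ v ≡ 1 → Vertex v
    c : ∀ {v} → v < n → κ v ≡ 2 → Vertex v
    a′ : ∀ {v} → v < n → κ v ≡ 0 → Vertex (n + countKind κ 0 v)
    x : Vertex top
    y : Vertex (suc top)

  top<m : top < m
  top<m = subst (top <_) (+-comm 2 top) (s≤s (n≤1+n top))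

  1+top<m : suc top < m
  1+top<m = subst (suc top <_) (+-comm 2 top) ≤-refl

  old<m : ∀ {v} → v < n → v < m
  old<m v<n = <-≤-trans v<n (≤-trans (m≤m+n n _) (m≤m+n top 2))

  copy<m : ∀ {v} → v < n → κ v ≡ 0 → n + countKind κ 0 v < m
  copy<m v<n p = <-trans (+-monoʳ-< n (count-< _ (≡ᵇ-true p) v<n)) top<m

  vertex : ∀ {v} → v < m → Vertex v
  vertex {v} v<m with v <? n
  ... | yes v<n with κ v in eq | κ<3 v<n
  ...   | 0 | _ = a v<n eq
  ...   | 1 | _ = b v<n eq
  ...   | 2 | _ = c v<n eq
  ...   | suc (suc (suc _)) | s≤s (s≤s (s≤s ()))
  vertex {v} v<m | no v≮n with v <? top | v ≟ top
  ... | no v≮top | no v≢top =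
    subst Vertex (≤-antisym (≤∧≢⇒< (≮⇒≥ v≮top) (≢-sym v≢top))
      (s≤s⁻¹ (subst (v <_) (+-comm top 2) v<m))) y
  ... | no _ | yes refl = x
  ... | yes v<top | _ =
    -- The offset beyond `n` is a rank in A, from which `count-surj` recovers the original.
    let r = v ∸ n
        n+r = m+[n∸m]≡n (≮⇒≥ v≮n)
        i , i<n , p , q = count-surj (λ i → κ i ≡ᵇ 0) n {r}
          (+-cancelˡ-< n _ _ (subst (_< top) (sym n+r) v<top))
    in subst Vertex (trans (cong (n +_) q) n+r) (a′ i<n (≡ᵇ-true⁻¹ p))

  kd-of : ∀ {v k} → v < n → κ v ≡ k → kd v ≡ k
  kd-of v<n p = trans (kd-old v<n) p

  ad-old : ∀ {u v} → u < n → v < n → ad (og u) (og v) ≡ α u v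
  ad-old u<n v<n = trans (cong₂ ad (og-old u<n) (og-old v<n)) (ad-α _ _)

  ad-copy : ∀ {u v} → u < n → v < n → κ v ≡ 0 → ad (og u) (og (n + countKind κ 0 v)) ≡ α u v
  ad-copy u<n v<n p = trans (cong₂ ad (og-old u<n) (og-copy v<n p)) (ad-α _ _)

  A⇒B : ∀ {u v} → u < n → κ u ≡ 0 → v < n → κ v ≡ 1 → α u v ≡ 1 → u ⇒ v
  A⇒B u<n p v<n q r = trans (proj₁ (edge-AB (kd-of u<n p) (kd-of v<n q)))
    (≡ᵇ-true (trans (ad-old u<n v<n) r))

  B⇒C : ∀ {u v} → u < n → κ u ≡ 1 → v < n → κ v ≡ 2 → α u v ≡ 1 → u ⇒ v
  B⇒C u<n p v<n q r = trans (proj₁ (edge-BC (kd-of u<n p) (kd-of v<n q)))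
    (≡ᵇ-true (trans (ad-old u<n v<n) r))

  A′⇒C : ∀ {u v} → u < n → κ u ≡ 0 → v < n → κ v ≡ 2 → α u v ≢ 1 → n + countKind κ 0 u ⇒ v
  A′⇒C u<n p v<n q r = trans (proj₂ (edge-CA′ (kd-of v<n q) (kd-copy u<n p)))
    (cong not (≡ᵇ-false λ e → r (trans (symmetric _ _) (trans (sym (ad-copy v<n u<n p)) e))))

  A⇒A′ : ∀ {u} → u < n → κ u ≡ 0 → u ⇒ n + countKind κ 0 u
  A⇒A′ u<n p = trans (proj₁ (edge-AA′ (kd-of u<n p) (kd-copy u<n p)))
    (≡ᵇ-true (trans (og-old u<n) (sym (og-copy u<n p))))

  A′⇒A : ∀ {u v} → u < n → κ u ≡ 0 → v < n → κ v ≡ 0 → v ≢ u → n + countKind κ 0 u ⇒ v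
  A′⇒A u<n p v<n q v≢u = trans (proj₂ (edge-AA′ (kd-of v<n q) (kd-copy u<n p)))
    (cong not (≡ᵇ-false λ e → v≢u (trans (sym (og-old v<n)) (trans e (og-copy u<n p)))))

  C⇒A : ∀ {u v} → u < n → κ u ≡ 2 → v < n → κ v ≡ 0 → u ⇒ v
  C⇒A u<n p v<n q = proj₂ (edge-AC (kd-of v<n q) (kd-of u<n p))

  A⇒x : ∀ {u} → u < n → κ u ≡ 0 → u ⇒ top
  A⇒x u<n p = proj₁ (edge-Ax (kd-of u<n p) kd-x)

  y⇒A : ∀ {u} → u < n → κ u ≡ 0 → suc top ⇒ u
  y⇒A u<n p = proj₂ (edge-Ay (kd-of u<n p) kd-y)

  B⇒A′ : ∀ {u v} → u < n → κ u ≡ 1 → v < n → κ v ≡ 0 → u ⇒ n + countKind κ 0 v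
  B⇒A′ u<n p v<n q = proj₁ (edge-BA′ (kd-of u<n p) (kd-copy v<n q))

  x⇒B : ∀ {u} → u < n → κ u ≡ 1 → top ⇒ u
  x⇒B u<n p = proj₂ (edge-Bx (kd-of u<n p) kd-x)

  B⇒y : ∀ {u} → u < n → κ u ≡ 1 → u ⇒ suc top
  B⇒y u<n p = proj₁ (edge-By (kd-of u<n p) kd-y)

  C⇒x : ∀ {u} → u < n → κ u ≡ 2 → u ⇒ top
  C⇒x u<n p = proj₁ (edge-Cx (kd-of u<n p) kd-x)

  y⇒C : ∀ {u} → u < n → κ u ≡ 2 → suc top ⇒ u
  y⇒C u<n p = proj₂ (edge-Cy (kd-of u<n p) kd-y)

  x⇒A′ : ∀ {u} → u < n → κ u ≡ 0 → top ⇒ n + countKind κ 0 u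
  x⇒A′ u<n p = proj₂ (edge-A′x (kd-copy u<n p) kd-x)

  y⇒A′ : ∀ {u} → u < n → κ u ≡ 0 → suc top ⇒ n + countKind κ 0 u
  y⇒A′ u<n p = proj₂ (edge-A′y (kd-copy u<n p) kd-y)

  x⇒y : top ⇒ suc top
  x⇒y = proj₁ (edge-xy kd-x kd-y)

  -- Ranks identify the class with the tournament of `beats-all`; an intermediate rank becomes a
  -- vertex again by `count-surj`.
  class-reach : ∀ {u v} k → 5 ≤ countKind κ k n → u < n → κ u ≡ k → v < n → κ v ≡ k → v ≢ u →
    Reach D m u v
  class-reach {u} {v} k 5≤ u<n p v<n q v≢u = conclude
      (beats-all 5≤ (rank< u<n p) (rank< v<n q) ranks-differ)
    where
    ck = countKind κ k

    rank< : ∀ {w} → w < n → κ w ≡ k → ck w < ck n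
    rank< w<n r = count-< _ (≡ᵇ-true r) w<n

    index< : ∀ {w w′} → ck w < ck w′ → w < w′
    index< lt = ≰⇒> λ w′≤w → <⇒≱ lt (count-mono _ w′≤w)

    ranks-differ : ck u ≢ ck v
    ranks-differ e with <-cmp u v
    ... | tri< u<v _ _ = <⇒≢ (count-< _ (≡ᵇ-true p) u<v) e
    ... | tri≈ _ r _   = v≢u (sym r)
    ... | tri> _ _ v<u = <⇒≢ (count-< _ (≡ᵇ-true q) v<u) (sym e)

    edge : ∀ {w w′} → w < n → κ w ≡ k → w′ < n → κ w′ ≡ k → Beats (ck n) (ck w) (ck w′) → w ⇒ w′
    edge {w} {w′} w<n r w′<n r′ beats = beats-edge {D = D} fl-0
      (trans (kd-of w<n r) (sym (kd-of w′<n r′)))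
      (trans (cong mk (kd-of w<n r)) (mk-size k))
      (λ lt → index< (subst₂ _<_ (rk≡ w<n r) (rk≡ w′<n r′) lt))
      (λ lt → index< (subst₂ _<_ (rk≡ w′<n r′) (rk≡ w<n r) lt))
      (pr≡ w<n r) (pr≡ w′<n r′)
      (subst₂ (Beats (ck n)) (sym (rk≡ w<n r)) (sym (rk≡ w′<n r′)) beats)
      where
      rk≡ : ∀ {w} → w < n → κ w ≡ k → rk w ≡ ck w
      rk≡ {w} w<n r = trans (rk-old w<n) (cong (λ k → countKind κ k w) r)

      pr≡ : ∀ {w} → w < n → κ w ≡ k → pr (rk w) ≡ par (rk w)
      pr≡ w<n r = pr-par (subst (_< n) (sym (rk≡ w<n r)) (<-≤-trans (rank< w<n r) (count≤ _ n)))

    conclude : Beats (ck n) (ck u) (ck v) ⊎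
      ∃[ r ] (r < ck n × Beats (ck n) (ck u) r × Beats (ck n) r (ck v)) → Reach D m u v
    conclude (inj₁ beats) = inj₁ (edge u<n p v<n q beats)
    conclude (inj₂ (r , r< , beats , beats′)) with count-surj _ n r<
    ... | w , w<n , s , refl = inj₂ (w , old<m w<n ,
      edge u<n p w<n (≡ᵇ-true⁻¹ s) beats , edge w<n (≡ᵇ-true⁻¹ s) v<n q beats′)

  -- Vertex 0 lies in A or has a neighbour there.
  someA : ∃[ u ] (u < n × κ u ≡ 0)
  someA with κ 0 in eq | κ<3 0<n
  ... | 0     | _ = 0 , 0<n , eq
  ... | suc _ | _ = let u , u<n , p , _ = neighbour 0 0<n (s≤s z≤n) (λ p → 0≢1+n (trans p eq))
                    in u , u<n , p

  nb : ∀ {v k} j → v < n → κ v ≡ k → j < 3 → j ≢ k → ∃[ u ] (u < n × κ u ≡ j × α v u ≡ 1)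
  nb j v<n p j<3 j≢k = neighbour j v<n j<3 λ q → j≢k (trans q p)

  -- y gives access to A and C. Since x beats B but loses to C, a neighbour in C leads to x.
  b-king : ∀ {v} → v < n → κ v ≡ 1 → Kingly D m v
  b-king {v} v<n p u<m u≢v with vertex u<m
  ... | a u<n q  = inj₂ (suc top , 1+top<m , B⇒y v<n p , y⇒A u<n q)
  ... | b u<n q  = class-reach 1 5≤B v<n p u<n q u≢v
  ... | c u<n q  = inj₂ (suc top , 1+top<m , B⇒y v<n p , y⇒C u<n q)
  ... | a′ u<n q = inj₁ (B⇒A′ v<n p u<n q)
  ... | y        = inj₁ (B⇒y v<n p)
  ... | x        = let w , w<n , q , r = nb 2 v<n p ≤-refl (λ ()) in
    inj₂ (w , old<m w<n , B⇒C v<n p w<n q r , C⇒x w<n q)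

  c-king : ∀ {v} → v < n → κ v ≡ 2 → Kingly D m v
  c-king {v} v<n p u<m u≢v with vertex u<m
  ... | a u<n q  = inj₁ (C⇒A v<n p u<n q)
  ... | b u<n q  = inj₂ (top , top<m , C⇒x v<n p , x⇒B u<n q)
  ... | c u<n q  = class-reach 2 5≤C v<n p u<n q u≢v
  ... | a′ u<n q = inj₂ (top , top<m , C⇒x v<n p , x⇒A′ u<n q)
  ... | x        = inj₁ (C⇒x v<n p)
  ... | y        = inj₂ (top , top<m , C⇒x v<n p , x⇒y)

  x-king : Kingly D m top
  x-king u<m u≢x with vertex u<m
  ... | a u<n q  = inj₂ (suc top , 1+top<m , x⇒y , y⇒A u<n q)
  ... | b u<n q  = inj₁ (x⇒B u<n q)
  ... | c u<n q  = inj₂ (suc top , 1+top<m , x⇒y , y⇒C u<n q)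
  ... | a′ u<n q = inj₁ (x⇒A′ u<n q)
  ... | x        = ⊥-elim (u≢x refl)
  ... | y        = inj₁ x⇒y

  -- y beats A, C and the copies. It enters B through a neighbour in A of the target, and reaches x
  -- through any vertex of A.
  y-king : Kingly D m (suc top)
  y-king u<m u≢y with vertex u<m
  ... | a u<n q  = inj₁ (y⇒A u<n q)
  ... | b u<n q  = let w , w<n , r , s = nb 0 u<n q (s≤s z≤n) (λ ()) in
    inj₂ (w , old<m w<n , y⇒A w<n r , A⇒B w<n r u<n q (trans (symmetric _ _) s))
  ... | c u<n q  = inj₁ (y⇒C u<n q)
  ... | a′ u<n q = inj₁ (y⇒A′ u<n q)
  ... | x        = let w , w<n , r = someA in inj₂ (w , old<m w<n , y⇒A w<n r , A⇒x w<n r)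
  ... | y        = ⊥-elim (u≢y refl)

  -- The copy of `v` has two purposes: it beats all of A but its original, and in C exactly the
  -- non-neighbours of its original. For the neighbours in C the triangle supplies the middle
  -- vertex; the rest is reached through x.
  good-king : ∀ {v} → v < n → κ v ≡ 0 → Good n κ α v → Kingly D m v
  good-king {v} v<n p good u<m u≢v with vertex u<m
  ... | a u<n q  = inj₂ (_ , copy<m v<n p , A⇒A′ v<n p , A′⇒A v<n p u<n q u≢v)
  ... | b u<n q  = inj₂ (top , top<m , A⇒x v<n p , x⇒B u<n q)
  ... | a′ u<n q = inj₂ (top , top<m , A⇒x v<n p , x⇒A′ u<n q)
  ... | x        = inj₁ (A⇒x v<n p)
  ... | y        = inj₂ (top , top<m , A⇒x v<n p , x⇒y)
  ... | c {u} u<n q with α v u ≟ 1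
  ...   | no  r = inj₂ (_ , copy<m v<n p , A⇒A′ v<n p , A′⇒C v<n p u<n q r)
  ...   | yes r = let w , w<n , s , t , t′ = good u<n q r in
    inj₂ (w , old<m w<n , A⇒B v<n p w<n s t , B⇒C w<n s u<n q t′)

  -- Only B and x beat y, and they beat every copy as well, so no path of length at most 2 leads
  -- from a copy to y.
  copy-not-king : ∀ {v} → v < n → κ v ≡ 0 → ¬ Kingly D m (n + countKind κ 0 v)
  copy-not-king {v} v<n p reach
    with reach 1+top<m (λ e → <⇒≢ (m≤n⇒m≤1+n (+-monoʳ-< n (count-< _ (≡ᵇ-true p) v<n))) (sym e))
  ... | inj₁ e = absurd e (proj₁ (edge-A′y (kd-copy v<n p) kd-y))
  ... | inj₂ (w , w<m , e , e′) with vertex w<m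
  ...   | a w<n q  = absurd e′ (proj₁ (edge-Ay (kd-of w<n q) kd-y))
  ...   | b w<n q  = absurd e (proj₂ (edge-BA′ (kd-of w<n q) (kd-copy v<n p)))
  ...   | c w<n q  = absurd e′ (proj₁ (edge-Cy (kd-of w<n q) kd-y))
  ...   | a′ w<n q = absurd e′ (proj₁ (edge-A′y (kd-copy w<n q) kd-y))
  ...   | x        = absurd e (proj₁ (edge-A′x (kd-copy v<n p) kd-x))
  ...   | y        = absurd e′ (edge-refl D (suc top))

  -- A beats nothing in C, so a path to a neighbour in C has a middle vertex. It lies in B and
  -- closes a triangle, or it is the copy of `v` itself; but that copy loses to every neighbour of
  -- `v` in C.
  king-good : ∀ {v} → v < n → κ v ≡ 0 → Kingly D m v → Good n κ α v
  king-good {v} v<n p reach {u} u<n q r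
    with reach (old<m u<n) (λ { refl → 0≢1+n (trans (sym p) q) })
  ... | inj₁ e = absurd e (proj₁ (edge-AC (kd-of v<n p) (kd-of u<n q)))
  ... | inj₂ (w , w<m , e , e′) with vertex w<m
  ...   | a w<n s  = absurd e′ (proj₁ (edge-AC (kd-of w<n s) (kd-of u<n q)))
  ...   | b w<n s  = w , w<n , s ,
    trans (sym (ad-old v<n w<n))
      (≡ᵇ-true⁻¹ (trans (sym (proj₁ (edge-AB (kd-of v<n p) (kd-of w<n s)))) e)) ,
    trans (sym (ad-old w<n u<n))
      (≡ᵇ-true⁻¹ (trans (sym (proj₁ (edge-BC (kd-of w<n s) (kd-of u<n q)))) e′))
  ...   | c w<n s  = absurd e (proj₁ (edge-AC (kd-of v<n p) (kd-of w<n s)))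
  ...   | x        = absurd e′ (proj₂ (edge-Cx (kd-of u<n q) kd-x))
  ...   | y        = absurd e (proj₁ (edge-Ay (kd-of v<n p) kd-y))
  ...   | a′ w<n s with trans (sym (og-old v<n)) (trans
          (≡ᵇ-true⁻¹ (trans (sym (proj₁ (edge-AA′ (kd-of v<n p) (kd-copy w<n s)))) e))
          (og-copy w<n s))
  ...     | refl = absurd e′ (trans (proj₂ (edge-CA′ (kd-of u<n q) (kd-copy v<n p)))
            (cong not (≡ᵇ-true (trans (ad-copy u<n v<n p) (trans (symmetric _ _) r)))))

  certain : ℕ → Bool
  certain v = alwaysKing (kd v)

  count-certain : count certain m ≡ countKind κ 1 n + countKind κ 2 n + 2
  count-certain = begin
    count certain m
      ≡⟨ cong (count certain) (+-comm top 2) ⟩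
    count certain (2 + top)
      ≡⟨ cong₂ (λ i j → bit (alwaysKing i) + (bit (alwaysKing j) + count certain top)) kd-y kd-x ⟩
    2 + count certain top
      ≡⟨ +-comm 2 _ ⟩
    count certain top + 2
      ≡⟨ cong (_+ 2) (count-+ certain n _) ⟩
    count certain n + count (λ r → certain (n + r)) (countKind κ 0 n) + 2
      ≡⟨ cong (λ k → count certain n + k + 2)
           (trans (count-cong _ copies) (count-false (countKind κ 0 n))) ⟩
    count certain n + 0 + 2
      ≡⟨ cong (_+ 2) (+-identityʳ _) ⟩
    count certain n + 2
      ≡⟨ cong (_+ 2) (count-cong n λ i i<n → cong alwaysKing (kd-old i<n)) ⟩
    count (alwaysKing ∘ κ) n + 2
      ≡⟨ cong (_+ 2) (count-alwaysKing κ n κ<3) ⟩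
    countKind κ 1 n + countKind κ 2 n + 2
      ∎
    where
    open ≡-Reasoning
    copies : ∀ r → r < countKind κ 0 n → certain (n + r) ≡ false
    copies r r< with count-surj _ n r<
    ... | i , i<n , p , refl = cong alwaysKing (kd-copy i<n (≡ᵇ-true⁻¹ p))

  certain-king : ∀ {v} → v < m → certain v ≡ true → Kingly D m v
  certain-king v<m e with vertex v<m
  ... | a v<n p  = absurd e (cong alwaysKing (kd-of v<n p))
  ... | b v<n p  = b-king v<n p
  ... | c v<n p  = c-king v<n p
  ... | a′ v<n p = absurd e (cong alwaysKing (kd-copy v<n p))
  ... | x        = x-king
  ... | y        = y-king

  good⇒kings : ∀ {v} → v < n → κ v ≡ 0 → Good n κ α v →
    HasKings (tournament {m} D) (countKind κ 1 n + countKind κ 2 n + 3)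
  good⇒kings {v} v<n p good = has-kings {D} {m} (λ u → certain u ∨ (u ≡ᵇ v)) kings
    (≤-reflexive (trans (+-suc _ 2) (sym (trans
      (count-insert certain m (cong alwaysKing (kd-of v<n p)) (old<m v<n)) (cong suc count-certain)))))
    where
    kings : ∀ {u} → u < m → certain u ∨ (u ≡ᵇ v) ≡ true → Kingly D m u
    kings {u} u<m e with certain u in eq
    ... | true  = certain-king u<m eq
    ... | false with ≡ᵇ-true⁻¹ {u} e
    ...   | refl = good-king v<n p good

  -- The target exceeds the number of certain kings by one, so there is a king of another kind.
  -- Copies are ruled out, which leaves A.
  kings⇒good : HasKings (tournament {m} D) (countKind κ 1 n + countKind κ 2 n + 3) →
    ∃[ v ] (v < n × κ v ≡ 0 × Good n κ α v)
  kings⇒good kings with another-king {D} {m} certain kings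
    (≤-reflexive (trans (cong suc count-certain) (sym (+-suc _ 2))))
  ... | v , v<m , e , v-king with vertex v<m
  ...   | a v<n p  = v , v<n , p , king-good v<n p v-king
  ...   | b v<n p  = absurd (cong alwaysKing (kd-of v<n p)) e
  ...   | c v<n p  = absurd (cong alwaysKing (kd-of v<n p)) e
  ...   | a′ v<n p = ⊥-elim (copy-not-king v<n p v-king)
  ...   | x        = absurd (cong alwaysKing kd-x) e
  ...   | y        = absurd (cong alwaysKing kd-y) e

-- Tournaments on a single kind: all kings, or at most one.

-- With a single kind the flag alone decides between a transitive tournament and one consisting of
-- kings only.
record Flat (m : ℕ) (D : Tables) : Set where
  open Tables D
  field
    kd-0   : ∀ {i} → i < m → kd i ≡ 0
    rk-id  : ∀ {i} → i < m → rk i ≡ i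
    pr-par : ∀ {i} → i < m → pr i ≡ par i
    mk-m   : mk 0 ≡ m

module _ {m : ℕ} {D : Tables} (F : Flat m D) where
  open Flat F
  open Tables D

  private
    same : ∀ {u v} → u < m → v < m → kd u ≡ kd v
    same u<m v<m = trans (kd-0 u<m) (sym (kd-0 v<m))

  flat-all-kings : ∀ {k} → fl ≡ 0 → 5 ≤ m → k ≤ m → HasKings (tournament {m} D) k
  flat-all-kings f 5≤m k≤m = has-kings {D} {m} (λ _ → true)
    (λ v<m _ u<m u≢v → reach (beats-all 5≤m v<m u<m (≢-sym u≢v)) v<m u<m)
    (subst (_ ≤_) (sym (count-true m)) k≤m)
    where
    edge : ∀ {u v} → u < m → v < m → Beats m u v → edgeOf D u v ≡ true
    edge u<m v<m beats = beats-edge {D = D} f (same u<m v<m) (trans (cong mk (kd-0 u<m)) mk-m)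
      (subst₂ _<_ (rk-id u<m) (rk-id v<m)) (subst₂ _<_ (rk-id v<m) (rk-id u<m))
      (pr-rk u<m) (pr-rk v<m)
      (subst₂ (Beats m) (sym (rk-id u<m)) (sym (rk-id v<m)) beats)
      where
      pr-rk : ∀ {u} → u < m → pr (rk u) ≡ par (rk u)
      pr-rk u<m = pr-par (subst (_< m) (sym (rk-id u<m)) u<m)

    reach : ∀ {u v} → Beats m u v ⊎ ∃[ w ] (w < m × Beats m u w × Beats m w v) →
      u < m → v < m → Reach D m u v
    reach (inj₁ beats) u<m v<m = inj₁ (edge u<m v<m beats)
    reach (inj₂ (w , w<m , beats , beats′)) u<m v<m =
      inj₂ (w , w<m , edge u<m w<m beats , edge w<m v<m beats′)

  -- All arrows point to smaller indices, so nothing enters the last vertex and no other vertex can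
  -- be a king.
  flat-one-king : ∀ {k} → fl ≡ 1 → 1 < k → ¬ HasKings (tournament {m} D) k
  flat-one-king f 1<k kings =
    let v , v<m , v≢last , v-king = another-king {D} {m} (λ v → suc v ≡ᵇ m) kings
          (≤-<-trans (count-last m) 1<k)
    in unreachable v<m (λ e → absurd (≡ᵇ-true e) v≢last) v-king
    where
    count-last : ∀ m → count (λ v → suc v ≡ᵇ m) m ≤ 1
    count-last zero    = z≤n
    count-last (suc m) rewrite ≡ᵇ-true {m} refl = s≤s (≤-reflexive (trans
      (count-cong m λ i i<m → ≡ᵇ-false (<⇒≢ i<m)) (count-false m)))

    no-edge : ∀ {u v} → u < v → v < m → edgeOf D u v ≡ false
    no-edge {u} {v} u<v v<m = trans (edge-same-< D (same (<-trans u<v v<m) v<m) u<v) lemma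
      where
      lemma : inner-edge D u v ≡ false
      lemma rewrite f = refl

    unreachable : ∀ {v} → v < m → suc v ≢ m → ¬ Kingly D m v
    unreachable {v} v<m v≢last reach = go m refl
      where
      go : ∀ l → l ≡ m → ⊥
      go (suc l) refl with reach {l} ≤-refl (λ e → v≢last (cong suc (sym e)))
      ... | inj₁ e = absurd e (no-edge (≤∧≢⇒< (s≤s⁻¹ v<m) (v≢last ∘ cong suc)) ≤-refl)
      ... | inj₂ (w , w<m , _ , e) with m≤n⇒m<n∨m≡n (s≤s⁻¹ w<m)
      ...   | inj₁ w<l  = absurd e (no-edge w<l ≤-refl)
      ...   | inj₂ refl = absurd e (edge-refl D w)

-- Preparing the tables.

exec-if-true : ∀ {b P Q s} → ⟦ b ⟧ᵇ s ≡ true → exec (ifᶜ b then P else Q) s ≡ exec P s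
exec-if-true e rewrite e = refl

exec-if-false : ∀ {b P Q s} → ⟦ b ⟧ᵇ s ≡ false → exec (ifᶜ b then P else Q) s ≡ exec Q s
exec-if-false e rewrite e = refl

-- Register 3 is the current vertex, register 4 the next free number, and register 2 counts the
-- vertices outside A. Array 8 counts each kind so far, so its entry is the rank of the current
-- vertex.
recordVertex addCopy scanStep scan extend parities : Cmd

recordVertex =
  put 3 (var 3) (lit 0) (var 3) ⨾
  put 4 (var 3) (lit 0) (get 8 (kind 3) (lit 0)) ⨾
  put 8 (kind 3) (lit 0) (inc (get 8 (kind 3) (lit 0)))

addCopy = put 1 (var 4) (lit 0) (lit 3) ⨾ put 3 (var 4) (lit 0) (var 3) ⨾ 4 := inc (var 4)

scanStep =
  recordVertex ⨾ (ifᶜ kind 3 == lit 0 then addCopy else 2 := inc (var 2)) ⨾ 3 := inc (var 3)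

scan = 4 := var 0 ⨾ upto 3 0 scanStep

extend =
  put 1 (var 4) (lit 0) (lit 4) ⨾ put 1 (inc (var 4)) (lit 0) (lit 5) ⨾
  1 := inc (inc (var 4)) ⨾ 2 := inc (inc (inc (var 2))) ⨾
  3 := lit 0 ⨾ 5 := lit 0 ⨾ 6 := lit 1

-- Registers 5 and 6 carry the parities of the current index and of its successor; swapping them
-- advances both.
parityStep : Cmd
parityStep =
  put 5 (var 3) (lit 0) (var 5) ⨾
  10 := var 5 ⨾ 5 := var 6 ⨾ 6 := var 10 ⨾ 3 := inc (var 3)

parities = upto 3 1 parityStep

hit : ∀ {a i i′ k s} → i′ ≡ i → arr (setArr a i 0 k s) a i′ 0 ≡ k
hit {a} {i} {k = k} {s} refl = setArr-same a i 0 k s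

miss : ∀ {a i i′ k s} → i′ ≢ i → arr (setArr a i 0 k s) a i′ 0 ≡ arr s a i′ 0
miss {a} {i} {i′} {k} {s} = setArr-row {a} {i} {0} {k} {s} {i′} {0}

module _ (n : ℕ) (κ : ℕ → ℕ) (α : ℕ → ℕ → ℕ) where
  private
    # : ℕ → ℕ → ℕ
    # = countKind κ
    end = n + # 0 n

  record Scanned (i : ℕ) (s : Memory) : Set where
    open Tables (tables s)
    field
      order   : reg s 0 ≡ n
      index   : reg s 3 ≡ i
      next    : reg s 4 ≡ n + # 0 i
      -- The additive form postpones truncated subtraction until the target is computed.
      others  : reg s 2 + # 0 i ≡ i
      fl-0    : fl ≡ 0
      ad-α    : ∀ u v → ad u v ≡ α u v
      -- This holds for the whole graph throughout: its kinds are part of the input, and kinds are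
      -- written only at numbers from `n` on.
      kd-old  : ∀ {j} → j < n → kd j ≡ κ j
      og-old  : ∀ {j} → j < i → og j ≡ j
      rk-old  : ∀ {j} → j < i → rk j ≡ # (κ j) j
      kd-copy : ∀ {j} → j < i → κ j ≡ 0 → kd (n + # 0 j) ≡ 3
      og-copy : ∀ {j} → j < i → κ j ≡ 0 → og (n + # 0 j) ≡ j
      mk-size : ∀ k → mk k ≡ # k i

  private
    count-skip : ∀ {i} → κ i ≢ 0 → # 0 (suc i) ≡ # 0 i
    count-skip {i} p rewrite ≡ᵇ-false p = refl

    module Step {i : ℕ} {s : Memory} (i<n : i < n) (S : Scanned i s) where
      open Scanned S
      open Tables (tables s) using (kd; og; rk; mk)

      s₀ s₁ s₂ : Memory
      s₀ = exec (put 3 (var 3) (lit 0) (var 3)) s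
      s₁ = exec recordVertex s
      s₂ = exec addCopy s₁

      kd-i : kd (reg s 3) ≡ κ i
      kd-i = trans (cong kd index) (kd-old i<n)

      below : ∀ {P : Set} {j} → (j ≡ i → P) → (j < i → P) → j < suc i → P
      below f g j<1+i with m≤n⇒m<n∨m≡n (s≤s⁻¹ j<1+i)
      ... | inj₁ j<i  = g j<i
      ... | inj₂ refl = f refl

      old≢i : ∀ {j} → j < i → j ≢ reg s 3
      old≢i j<i refl = <⇒≢ j<i index

      copy≢i : ∀ {j} → n + # 0 j ≢ reg s 3
      copy≢i {j} e = <⇒≱ i<n (≤-trans (m≤m+n n (# 0 j)) (≤-reflexive (trans e index)))

      old≢next : ∀ {j} → j < n → j ≢ reg s 4
      old≢next j<n e = <⇒≱ j<n (≤-trans (m≤m+n n (# 0 i)) (≤-reflexive (sym (trans e next))))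

      copy≢next : ∀ {j} → j < i → κ j ≡ 0 → n + # 0 j ≢ reg s 4
      copy≢next {j} j<i p e =
        <⇒≢ (count-< _ (≡ᵇ-true p) j<i) (+-cancelˡ-≡ n _ _ (trans e next))

      og₁ : ∀ {j} → j < suc i → arr s₁ 3 j 0 ≡ j
      og₁ {j} = below (λ e → trans (hit {3} {s = s} (trans e (sym index))) (trans index (sym e)))
        (λ j<i → trans (miss {3} {s = s} (old≢i j<i)) (og-old j<i))

      rk₁ : ∀ {j} → j < suc i → arr s₁ 4 j 0 ≡ # (κ j) j
      rk₁ {j} = below
        (λ { refl → trans (hit {4} {s = s₀} (sym index)) (trans (cong mk kd-i) (mk-size _)) })
        (λ j<i → trans (miss {4} {s = s₀} (old≢i j<i)) (rk-old j<i))

      mk₁ : ∀ k → arr s₁ 8 k 0 ≡ # k (suc i)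
      mk₁ k with κ i ≟ k
      ... | yes refl rewrite ≡ᵇ-true {κ i} refl =
        trans (hit {8} {s = s′} (sym kd-i)) (cong suc (trans (cong mk kd-i) (mk-size _)))
        where s′ = exec (put 3 (var 3) (lit 0) (var 3) ⨾
                         put 4 (var 3) (lit 0) (get 8 (kind 3) (lit 0))) s
      ... | no  p rewrite ≡ᵇ-false p =
        trans (miss {8} {s = s′} (λ e → p (sym (trans e kd-i)))) (mk-size k)
        where s′ = exec (put 3 (var 3) (lit 0) (var 3) ⨾
                         put 4 (var 3) (lit 0) (get 8 (kind 3) (lit 0))) s

      in-A : κ i ≡ 0 → Scanned (suc i) (exec (3 := inc (var 3)) s₂)
      in-A p = record
        { order   = order
        ; index   = cong suc index
        ; next    = trans (cong suc next) (sym (trans (cong (n +_) grow) (+-suc n (# 0 i))))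
        ; others  = trans (cong (reg s 2 +_) grow) (trans (+-suc (reg s 2) (# 0 i)) (cong suc others))
        ; fl-0    = fl-0
        ; ad-α    = ad-α
        ; kd-old  = λ j<n → trans (miss {1} {s = s₁} (old≢next j<n)) (kd-old j<n)
        ; og-old  = λ j<1+i → trans (miss {3} {s = s₁′} (old≢next (<-≤-trans j<1+i i<n))) (og₁ j<1+i)
        ; rk-old  = rk₁
        ; kd-copy = below
            (λ { refl _ → hit {1} {s = s₁} (sym next) })
            (λ j<i q → trans (miss {1} {s = s₁} (copy≢next j<i q)) (kd-copy j<i q))
        ; og-copy = λ {j} → below
            (λ { refl _ → trans (hit {3} {s = s₁′} (sym next)) index })
            (λ j<i q → trans (miss {3} {s = s₁′} (copy≢next j<i q))
              (trans (miss {3} {s = s} (copy≢i {j})) (og-copy j<i q)))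
        ; mk-size = mk₁
        }
        where
        s₁′ = setArr 1 (reg s 4) 0 3 s₁
        grow : # 0 (suc i) ≡ suc (# 0 i)
        grow = count-step (λ j → κ j ≡ᵇ 0) (≡ᵇ-true p)

      not-in-A : κ i ≢ 0 → Scanned (suc i) (exec (2 := inc (var 2) ⨾ 3 := inc (var 3)) s₁)
      not-in-A p = record
        { order   = order
        ; index   = cong suc index
        ; next    = trans next (cong (n +_) (sym (count-skip p)))
        ; others  = cong suc (trans (cong (reg s 2 +_) (count-skip p)) others)
        ; fl-0    = fl-0
        ; ad-α    = ad-α
        ; kd-old  = kd-old
        ; og-old  = og₁
        ; rk-old  = rk₁
        ; kd-copy = below (λ { refl q → ⊥-elim (p q) }) kd-copy
        ; og-copy = λ {j} → below (λ { refl q → ⊥-elim (p q) })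
            (λ j<i q → trans (miss {3} {s = s} (copy≢i {j})) (og-copy j<i q))
        ; mk-size = mk₁
        }

      result : Scanned (suc i) (exec scanStep s)
      result with κ i ≟ 0
      ... | yes p = subst (λ s′ → Scanned (suc i) (exec (3 := inc (var 3)) s′))
        (sym (exec-if-true {kind 3 == lit 0} {addCopy} {2 := inc (var 2)} {s₁}
          (≡ᵇ-true (trans kd-i p)))) (in-A p)
      ... | no  p = subst (λ s′ → Scanned (suc i) (exec (3 := inc (var 3)) s′))
        (sym (exec-if-false {kind 3 == lit 0} {addCopy} {2 := inc (var 2)} {s₁}
          (≡ᵇ-false λ e → p (trans (sym kd-i) e)))) (not-in-A p)

  scan-runs : ∀ {s} → Scanned 0 (exec (4 := var 0) s) →
    Run scan s (2 + (n * (4 + time scanStep) + 4)) (Scanned n)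
  scan-runs start = run-⨾ {Q = Scanned 0} (run-straight (4 := var 0) _ start)
    (run-upto Scanned Scanned.index Scanned.order
      (λ i<n S → run-straight scanStep _ (Step.result i<n S)))

  record Prepared (s : Memory) : Set where
    field
      order  : reg s 0 ≡ n
      order′ : reg s 1 ≡ end + 2
      target : reg s 2 ≡ n ∸ # 0 n + 3
      layout : Layout n κ α (tables s)

  record Parities (i : ℕ) (s : Memory) : Set where
    field
      prepared : Prepared s
      index    : reg s 3 ≡ i
      current  : reg s 5 ≡ par i
      coming   : reg s 6 ≡ par (suc i)
      pr-par   : ∀ {j} → j < i → arr s 5 j 0 ≡ par j

  extend-prepares : ∀ {s} → Scanned n s → Parities 0 (exec extend s)
  extend-prepares {s} S = record
    { prepared = record
      { order  = order
      ; order′ = trans (+-comm 2 (reg s 4)) (cong (_+ 2) next)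
      ; target = trans (+-comm 3 (reg s 2)) (cong (_+ 3)
          (trans (sym (m+n∸n≡m (reg s 2) (# 0 n))) (cong (_∸ # 0 n) others)))
      ; layout = record
        { kd-old  = λ {j} j<n → trans (kd-below (<-≤-trans j<n (m≤m+n n (# 0 n)))) (kd-old j<n)
        ; og-old  = og-old
        ; rk-old  = rk-old
        ; kd-copy = λ j<n p →
            trans (kd-below (+-monoʳ-< n (count-< _ (≡ᵇ-true p) j<n))) (kd-copy j<n p)
        ; og-copy = og-copy
        ; kd-x    = trans (miss {1} {s = setArr 1 (reg s 4) 0 4 s} (<⇒≢ (s≤s (≤-reflexive (sym next)))))
            (hit {1} {s = s} (sym next))
        ; kd-y    = hit {1} {s = setArr 1 (reg s 4) 0 4 s} (cong suc (sym next))
        ; mk-size = mk-size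
        ; ad-α    = ad-α
        ; fl-0    = fl-0
        }
      }
    ; index    = refl
    ; current  = refl
    ; coming   = refl
    ; pr-par   = λ ()
    }
    where
    open Scanned S
    kd-below : ∀ {j} → j < end → arr (exec extend s) 1 j 0 ≡ arr s 1 j 0
    kd-below {j} j<end = trans (miss {1} {s = setArr 1 (reg s 4) 0 4 s} (<⇒≢ (m≤n⇒m≤1+n j<next)))
      (miss {1} {s = s} (<⇒≢ j<next))
      where
      j<next : j < reg s 4
      j<next = subst (j <_) (sym next) j<end

  parityStep-steps : ∀ {i s} → Parities i s → Parities (suc i) (exec parityStep s)
  parityStep-steps {i} {s} P = record
    { prepared = record { Prepared prepared ; layout = record { Layout (Prepared.layout prepared) } }
    ; index    = cong suc index
    ; current  = coming
    ; coming   = current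
    ; pr-par   = λ j<1+i → written (m≤n⇒m<n∨m≡n (s≤s⁻¹ j<1+i))
    }
    where
    open Parities P
    written : ∀ {j} → j < i ⊎ j ≡ i → arr (exec parityStep s) 5 j 0 ≡ par j
    written (inj₁ j<i)  = trans (miss {5} {s = s} λ e → <⇒≢ j<i (trans e index)) (pr-par j<i)
    written (inj₂ refl) = trans (hit {5} {s = s} (sym index)) current

  parities-runs : ∀ {s} → Parities 0 s →
    Run parities s ((end + 2) * (4 + time parityStep) + 4) (Parities (end + 2))
  parities-runs = run-upto Parities Parities.index (Prepared.order′ ∘ Parities.prepared)
    (λ _ P → run-straight parityStep _ (parityStep-steps P))

-- Flattening the tables to a single kind.

flattenStep flatten : Cmd
flattenStep = put 1 (var 3) (lit 0) (lit 0) ⨾ put 4 (var 3) (lit 0) (var 3) ⨾ 3 := inc (var 3)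
flatten = put 8 (lit 0) (lit 0) (var 1) ⨾ 3 := lit 0 ⨾ upto 3 1 flattenStep

record Flattened (m k f i : ℕ) (s : Memory) : Set where
  field
    order  : reg s 1 ≡ m
    target : reg s 2 ≡ k
    index  : reg s 3 ≡ i
    fl-f   : reg s 9 ≡ f
    kd-0   : ∀ {j} → j < i → arr s 1 j 0 ≡ 0
    rk-id  : ∀ {j} → j < i → arr s 4 j 0 ≡ j
    pr-par : ∀ {j} → j < m → arr s 5 j 0 ≡ par j
    mk-m   : arr s 8 0 0 ≡ m

flattenStep-steps : ∀ {m k f i s} → Flattened m k f i s →
  Flattened m k f (suc i) (exec flattenStep s)
flattenStep-steps {i = i} {s} F = record
  { Flattened F
  ; index = cong suc index
  ; kd-0  = λ j<1+i → kd (m≤n⇒m<n∨m≡n (s≤s⁻¹ j<1+i))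
  ; rk-id = λ j<1+i → rk (m≤n⇒m<n∨m≡n (s≤s⁻¹ j<1+i))
  }
  where
  open Flattened F
  s₁ = setArr 1 (reg s 3) 0 0 s

  kd : ∀ {j} → j < i ⊎ j ≡ i → arr s₁ 1 j 0 ≡ 0
  kd (inj₁ j<i)  = trans (miss {1} {s = s} λ e → <⇒≢ j<i (trans e index)) (kd-0 j<i)
  kd (inj₂ refl) = hit {1} {s = s} (sym index)

  rk : ∀ {j} → j < i ⊎ j ≡ i → arr (setArr 4 (reg s 3) 0 (reg s 3) s₁) 4 j 0 ≡ j
  rk (inj₁ j<i)  = trans (miss {4} {s = s₁} λ e → <⇒≢ j<i (trans e index)) (rk-id j<i)
  rk (inj₂ refl) = trans (hit {4} {s = s₁} (sym index)) index

flattenTime : ℕ → ℕ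
flattenTime m = 4 + (2 + (m * (4 + time flattenStep) + 4))

flatten-runs : ∀ {m k f s} → reg s 1 ≡ m → reg s 2 ≡ k → reg s 9 ≡ f →
  (∀ {j} → j < m → arr s 5 j 0 ≡ par j) →
  Run flatten s (flattenTime m) (Flattened m k f m)
flatten-runs {m} {k} {f} {s} order target fl-f pr-par =
  run-⨾ {Q = λ s′ → Flattened m k f 0 (exec (3 := lit 0) s′)}
    (run-straight (put 8 (lit 0) (lit 0) (var 1)) _ record
      { order = order ; target = target ; index = refl ; fl-f = fl-f
      ; kd-0 = λ () ; rk-id = λ () ; pr-par = pr-par
      ; mk-m = trans (setArr-same 8 0 0 (reg s 1) s) order }) λ start →
  run-⨾ {Q = Flattened m k f 0} (run-straight (3 := lit 0) _ start)
    (run-upto (Flattened m k f) Flattened.index Flattened.order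
      (λ _ F → run-straight flattenStep _ (flattenStep-steps F)))

-- Exhaustive search for a witness.

any : (ℕ → Bool) → ℕ → Bool
any p zero    = false
any p (suc n) = p n ∨ any p n

any⇒∃ : ∀ p n → any p n ≡ true → ∃[ i ] (i < n × p i ≡ true)
any⇒∃ p (suc n) e with p n in eq
... | true  = n , ≤-refl , eq
... | false = let i , i<n , q = any⇒∃ p n e in i , m≤n⇒m≤1+n i<n , q

∃⇒any : ∀ p {n i} → i < n → p i ≡ true → any p n ≡ true
∃⇒any p {suc n} i<1+n e with p n in eq
... | true = refl
... | false with m≤n⇒m<n∨m≡n (s≤s⁻¹ i<1+n)
...   | inj₁ i<n  = ∃⇒any p i<n e
...   | inj₂ refl with trans (sym e) eq
...     | ()

any-true : ∀ p {j} → p j ≡ true → any p (suc j) ≡ true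
any-true p e rewrite e = refl

any-false : ∀ p {j} → p j ≡ false → any p (suc j) ≡ any p j
any-false p e rewrite e = refl

viaTest badTest goodTest : Test
viaTest  = kind 5 == lit 1 and get 0 (var 3) (var 5) == lit 1 and get 0 (var 5) (var 4) == lit 1
badTest  = kind 4 == lit 2 and get 0 (var 3) (var 4) == lit 1 and var 10 == lit 0
goodTest = kind 3 == lit 0 and var 11 == lit 0

flag : Test → ℕ → ℕ → Cmd
flag t f k = ifᶜ t then f := lit k else skip

-- Register 10 records that an edge ac lies in a triangle, register 11 that some c refutes a, and
-- register 9 that no witness has been found yet. Register 9 is the flag read by `inner`: it drops
-- to 0 once a witness appears.
viaStep badStep goodStep search : Cmd
viaStep  = flag viaTest 10 1 ⨾ 5 := inc (var 5)
badStep  = (10 := lit 0 ⨾ 5 := lit 0) ⨾ upto 5 0 viaStep ⨾ flag badTest 11 1 ⨾ 4 := inc (var 4)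
goodStep = (11 := lit 0 ⨾ 4 := lit 0) ⨾ upto 4 0 badStep ⨾ flag goodTest 9 0 ⨾ 3 := inc (var 3)
search   = (9 := lit 1 ⨾ 3 := lit 0) ⨾ upto 3 0 goodStep

exec-flag : ∀ t f k {s} (Q : Memory → Set) →
  (⟦ t ⟧ᵇ s ≡ true → Q (setReg f k s)) → (⟦ t ⟧ᵇ s ≡ false → Q s) → Q (exec (flag t f k) s)
exec-flag t f k {s} Q yes′ no′ with ⟦ t ⟧ᵇ s
... | true  = yes′ refl
... | false = no′ refl

badTime goodTime searchTime : ℕ → ℕ
badTime n    = 4 + (n * (4 + time viaStep) + 4 + time (flag badTest 11 1 ⨾ 4 := inc (var 4)))
goodTime n   = 4 + (n * (4 + badTime n) + 4 + time (flag goodTest 9 0 ⨾ 3 := inc (var 3)))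
searchTime n = 4 + (n * (4 + goodTime n) + 4)

module Search (n m k : ℕ) (M : ℕ → ℕ → ℕ → ℕ) where
  via : ℕ → ℕ → ℕ → Bool
  via a c b = (M 1 b 0 ≡ᵇ 1) ∧ ((M 0 a b ≡ᵇ 1) ∧ (M 0 b c ≡ᵇ 1))

  bad : ℕ → ℕ → Bool
  bad a c = (M 1 c 0 ≡ᵇ 2) ∧ ((M 0 a c ≡ᵇ 1) ∧ (bit (any (via a c) n) ≡ᵇ 0))

  good : ℕ → Bool
  good a = (M 1 a 0 ≡ᵇ 0) ∧ (bit (any (bad a) n) ≡ᵇ 0)

  -- The search writes registers only, so the arrays can be required to stay equal as a whole.
  record Frame (s : Memory) : Set where
    constructor framed
    field
      memory≡ : arr s ≡ M
      order   : reg s 0 ≡ n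
      order′  : reg s 1 ≡ m
      target  : reg s 2 ≡ k

  record Goods (a : ℕ) (s : Memory) : Set where
    constructor goods
    field
      frame  : Frame s
      vertex : reg s 3 ≡ a
      found  : reg s 9 ≡ bit (not (any good a))

  record Bads (g a c : ℕ) (s : Memory) : Set where
    constructor bads
    field
      frame  : Frame s
      outer  : reg s 3 ≡ a
      kept   : reg s 9 ≡ g
      vertex : reg s 4 ≡ c
      found  : reg s 11 ≡ bit (any (bad a) c)

  record Vias (g h a c b : ℕ) (s : Memory) : Set where
    constructor vias
    field
      frame  : Frame s
      outer  : reg s 3 ≡ a
      middle : reg s 4 ≡ c
      kept   : reg s 9 ≡ g
      kept′  : reg s 11 ≡ h
      vertex : reg s 5 ≡ b
      found  : reg s 10 ≡ bit (any (via a c) b)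

  vias-step : ∀ {g h a c b s} → Vias g h a c b s → Vias g h a c (suc b) (exec viaStep s)
  vias-step {g} {h} {s = mem r _} (vias (framed refl o o′ t) refl refl p p′ refl f) =
    exec-flag viaTest 10 1 (Vias g h (r 3) (r 4) (suc (r 5)) ∘ exec (5 := inc (var 5)))
      (λ e → vias (framed refl o o′ t) refl refl p p′ refl
        (cong bit (sym (any-true (via (r 3) (r 4)) e))))
      (λ e → vias (framed refl o o′ t) refl refl p p′ refl
        (trans f (cong bit (sym (any-false (via (r 3) (r 4)) e)))))

  bads-step : ∀ {g a c s} → Vias g (bit (any (bad a) c)) a c n s →
    Bads g a (suc c) (exec (flag badTest 11 1 ⨾ 4 := inc (var 4)) s)
  bads-step {g} {s = mem r _} (vias (framed refl o o′ t) refl refl p p′ refl f) =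
    exec-flag badTest 11 1 (Bads g (r 3) (suc (r 4)) ∘ exec (4 := inc (var 4)))
      (λ e → bads (framed refl o o′ t) refl p refl
        (cong bit (sym (any-true (bad (r 3)) (trans (sym test) e)))))
      (λ e → bads (framed refl o o′ t) refl p refl
        (trans p′ (cong bit (sym (any-false (bad (r 3)) (trans (sym test) e))))))
    where
    test : ⟦ badTest ⟧ᵇ (mem r M) ≡ bad (r 3) (r 4)
    test rewrite f = refl

  badStep-runs : ∀ {g a c s} → Bads g a c s → Run badStep s (badTime n) (Bads g a (suc c))
  badStep-runs {g} {a} {c} (bads (framed refl o o′ t) p q refl f) =
    run-⨾ {Q = Vias g _ a c 0} (run-straight (10 := lit 0 ⨾ 5 := lit 0) _
      (vias (framed refl o o′ t) p refl q f refl refl)) λ start →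
    run-⨾ (run-upto (Vias g _ a c) Vias.vertex (Frame.order ∘ Vias.frame)
      (λ _ V → run-straight viaStep _ (vias-step V)) start) λ V →
    run-straight (flag badTest 11 1 ⨾ 4 := inc (var 4)) _ (bads-step V)

  goods-step : ∀ {a s} → Bads (bit (not (any good a))) a n s →
    Goods (suc a) (exec (flag goodTest 9 0 ⨾ 3 := inc (var 3)) s)
  goods-step {s = mem r _} (bads (framed refl o o′ t) refl p refl f) =
    exec-flag goodTest 9 0 (Goods (suc (r 3)) ∘ exec (3 := inc (var 3)))
      (λ e → goods (framed refl o o′ t) refl
        (cong (bit ∘ not) (sym (any-true good (trans (sym test) e)))))
      (λ e → goods (framed refl o o′ t) refl
        (trans p (cong (bit ∘ not) (sym (any-false good (trans (sym test) e))))))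
    where
    test : ⟦ goodTest ⟧ᵇ (mem r M) ≡ good (r 3)
    test rewrite f = refl

  goodStep-runs : ∀ {a s} → Goods a s → Run goodStep s (goodTime n) (Goods (suc a))
  goodStep-runs {a} (goods (framed refl o o′ t) refl f) =
    run-⨾ {Q = Bads _ a 0} (run-straight (11 := lit 0 ⨾ 4 := lit 0) _
      (bads (framed refl o o′ t) refl f refl refl)) λ start →
    run-⨾ (run-upto (Bads _ a) Bads.vertex (Frame.order ∘ Bads.frame)
      (λ _ → badStep-runs) start) λ done′ →
    run-straight (flag goodTest 9 0 ⨾ 3 := inc (var 3)) _ (goods-step done′)

  search-runs : ∀ {s} → Frame s → Run search s (searchTime n) (Goods n)
  search-runs (framed refl o o′ t) =
    run-⨾ {Q = Goods 0} (run-straight (9 := lit 1 ⨾ 3 := lit 0) _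
      (goods (framed refl o o′ t) refl refl)) λ start →
    run-upto Goods Goods.vertex (Frame.order ∘ Goods.frame) (λ _ → goodStep-runs) start

-- The size threshold and the quadratic time bound.

large : ∀ {δ} (n s : ℕ) → 0ℚ <ℚ δ → 5 * ℚ.↧ₙ δ ≤ n →
  δ ℚ.* (ℤ.+ n ℚ./ 1) ℚ.≤ (ℤ.+ s ℚ./ 1) → 5 ≤ s
large {mkℚ (ℤ.+ zero)    d _} n s (ℚ.*<* (ℤ.+<+ ())) _ _
large {mkℚ (ℤ.-[1+ _ ]) d _} n s (ℚ.*<* ()) _ _
large {δ@(mkℚ (ℤ.+ suc p) d _)} n s _ N≤n δn≤s =
  -- With δ = (p + 1) / (d + 1): 5 (d + 1) ≤ n ≤ (p + 1) n ≤ s (d + 1), and d + 1 cancels.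
  *-cancelʳ-≤ 5 s (suc d) (≤-trans N≤n (≤-trans (m≤n*m n (suc p)) (ℤₚ.drop‿+≤+
    (subst₂ ℤ._≤_ left right (ℚᵘₚ.drop-*≤* unnormalised)))))
  where
  -- Normalised products involve a gcd; unnormalised fractions leave a plain inequality between
  -- integers.
  unnormalised : toℚᵘ δ ℚᵘ.* ℚᵘ.mkℚᵘ (ℤ.+ n) 0 ℚᵘ.≤ ℚᵘ.mkℚᵘ (ℤ.+ s) 0
  unnormalised =
    ℚᵘₚ.≤-respʳ-≃ (ℚₚ.toℚᵘ-fromℚᵘ (ℚᵘ.mkℚᵘ (ℤ.+ s) 0))
      (ℚᵘₚ.≤-respˡ-≃ (ℚᵘₚ.≃-trans (ℚₚ.toℚᵘ-homo-* δ (ℤ.+ n ℚ./ 1))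
          (ℚᵘₚ.*-congˡ {toℚᵘ δ} (ℚₚ.toℚᵘ-fromℚᵘ (ℚᵘ.mkℚᵘ (ℤ.+ n) 0))))
        (ℚₚ.toℚᵘ-mono-≤ δn≤s))

  left : (ℤ.+ suc p ℤ.* ℤ.+ n) ℤ.* ℤ.+ 1 ≡ ℤ.+ (suc p * n)
  left = trans (ℤₚ.*-identityʳ _) (sym (ℤₚ.pos-* (suc p) n))

  right : ℤ.+ s ℤ.* ℤ.+ (suc d * 1) ≡ ℤ.+ (s * suc d)
  right = trans (cong (λ k → ℤ.+ s ℤ.* ℤ.+ k) (*-identityʳ (suc d))) (sym (ℤₚ.pos-* s (suc d)))

fillTime : ℕ → ℕ
fillTime m = 2 + (m * (4 + (2 + (m * (4 + time fillCell) + 4 + 3))) + 4)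

totalTime : ℕ → ℕ → ℕ
totalTime n m =
  2 + (n * (4 + time scanStep) + 4) +
  (time extend + (m * (4 + time parityStep) + 4 + (5 + fillTime m)))

-- The coefficient is obtained by putting 1 for n and 3 for m.
totalTime-quadratic : ∀ {n m} → 1 ≤ n → m ≤ 3 * n → totalTime n m ≤ totalTime 1 3 * n ^ 2
totalTime-quadratic {n} {m} 1≤n m≤3n =
  let scan≼     = plus (const 2) (plus (times n≼ (const (4 + time scanStep) {1})) (const 4))
      parities≼ = plus (times m≼ (const (4 + time parityStep) {1})) (const 4)
      fill≼     = plus (const 2) (plus (times m≼ row) (const 4))
  in _≼[_]_.bound {totalTime n m} {2} {totalTime 1 3}
       (plus scan≼ (plus (const (time extend)) (plus parities≼ (plus (const 5) fill≼))))
  where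
  infix 4 _≼[_]_
  record _≼[_]_ (i e k : ℕ) : Set where
    eta-equality
    constructor ⟨_⟩
    field bound : i ≤ k * n ^ e

  -- Powers of a positive `n` are at least 1, so a constant may be charged to any degree. This
  -- brings the summands to a common degree.
  const : ∀ k {e} → k ≼[ e ] k
  const k {e} = ⟨ ≤-trans (≤-reflexive (sym (*-identityʳ k)))
    (*-monoʳ-≤ k (m^n>0 n {{>-nonZero 1≤n}} e)) ⟩

  plus : ∀ {i j k l e} → i ≼[ e ] k → j ≼[ e ] l → i + j ≼[ e ] k + l
  plus {k = k} {l} {e} ⟨ p ⟩ ⟨ q ⟩ =
    ⟨ ≤-trans (+-mono-≤ p q) (≤-reflexive (sym (*-distribʳ-+ (n ^ e) k l))) ⟩

  times : ∀ {d e i j k l} → i ≼[ d ] k → j ≼[ e ] l → i * j ≼[ d + e ] k * l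
  times {d} {e} {k = k} {l} ⟨ p ⟩ ⟨ q ⟩ = ⟨ ≤-trans (*-mono-≤ p q) (≤-reflexive
    (trans ([m*n]*[o*p]≡[m*o]*[n*p] k (n ^ d) l (n ^ e)) (cong (k * l *_) (sym (^-distribˡ-+-* n d e))))) ⟩

  n≼ : n ≼[ 1 ] 1
  n≼ = ⟨ ≤-reflexive (sym (trans (*-identityˡ (n ^ 1)) (*-identityʳ n))) ⟩

  m≼ : m ≼[ 1 ] 3
  m≼ = ⟨ ≤-trans m≤3n (≤-reflexive (cong (3 *_) (sym (*-identityʳ n)))) ⟩

  row : 4 + (2 + (m * (4 + time fillCell) + 4 + 3)) ≼[ 1 ] 4 + (2 + (3 * (4 + time fillCell) + 4 + 3))
  row = plus (const 4) (plus (const 2)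
    (plus (plus (times m≼ (const (4 + time fillCell) {0})) (const 4)) (const 3)))

-- From instances to functions on natural numbers.

module Encoding (G : TripartiteGraph) where
  open TripartiteGraph G

  partCode-fromℕ< : ∀ {v} (v<n : v < n) → partCode G v ≡ code (part (fromℕ< v<n))
  partCode-fromℕ< {v} v<n with v <? n
  ... | yes _  = refl
  ... | no v≮n = ⊥-elim (v≮n v<n)

  adjBit-fromℕ< : ∀ {u v} (u<n : u < n) (v<n : v < n) →
    adjBit G u v ≡ bit (adj (fromℕ< u<n) (fromℕ< v<n))
  adjBit-fromℕ< {u} {v} u<n v<n with u <? n | v <? n
  ... | yes _  | yes _  = refl
  ... | no u≮n | _      = ⊥-elim (u≮n u<n)
  ... | yes _  | no v≮n = ⊥-elim (v≮n v<n)

  partCode-toℕ : ∀ v → partCode G (toℕ v) ≡ code (part v)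
  partCode-toℕ v = trans (partCode-fromℕ< (Finₚ.toℕ<n v))
    (cong (code ∘ part) (Finₚ.fromℕ<-toℕ v (Finₚ.toℕ<n v)))

  adjBit-toℕ : ∀ u v → adjBit G (toℕ u) (toℕ v) ≡ bit (adj u v)
  adjBit-toℕ u v = trans (adjBit-fromℕ< (Finₚ.toℕ<n u) (Finₚ.toℕ<n v))
    (cong₂ (λ u v → bit (adj u v)) (Finₚ.fromℕ<-toℕ u (Finₚ.toℕ<n u))
      (Finₚ.fromℕ<-toℕ v (Finₚ.toℕ<n v)))

  adjBit-sym : ∀ u v → adjBit G u v ≡ adjBit G v u
  adjBit-sym u v with u <? n | v <? n
  ... | yes _ | yes _ = cong bit (adj-sym _ _)
  ... | yes _ | no  _ = refl
  ... | no  _ | yes _ = refl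
  ... | no  _ | no  _ = refl

  code<3 : ∀ p → code p < 3
  code<3 A = s≤s z≤n
  code<3 B = s≤s (s≤s z≤n)
  code<3 C = ≤-refl

  code-injective : ∀ {p q} → code p ≡ code q → p ≡ q
  code-injective {A} {A} _ = refl
  code-injective {B} {B} _ = refl
  code-injective {C} {C} _ = refl

  decode : ∀ {k} → k < 3 → ∃[ p ] code p ≡ k
  decode {0} _ = A , refl
  decode {1} _ = B , refl
  decode {2} _ = C , refl
  decode {suc (suc (suc _))} (s≤s (s≤s (s≤s ())))

  bit-true : ∀ {b} → bit b ≡ 1 → b ≡ true
  bit-true {true} _ = refl

  does-≟ᴾ : ∀ p q → does (p ≟ᴾ q) ≡ (code p ≡ᵇ code q)
  does-≟ᴾ A A = refl
  does-≟ᴾ A B = refl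
  does-≟ᴾ A C = refl
  does-≟ᴾ B A = refl
  does-≟ᴾ B B = refl
  does-≟ᴾ B C = refl
  does-≟ᴾ C A = refl
  does-≟ᴾ C B = refl
  does-≟ᴾ C C = refl

  size-count : ∀ p → size p ≡ countKind (partCode G) (code p) n
  size-count p = trans
    (cong ∣_∣ (tabulate-cong λ v →
      trans (does-≟ᴾ (part v) p) (cong (_≡ᵇ code p) (sym (partCode-toℕ v)))))
    (∣select∣ n (λ i → partCode G i ≡ᵇ code p))

countKind-sum : ∀ κ n → (∀ {i} → i < n → κ i < 3) →
  countKind κ 0 n + (countKind κ 1 n + countKind κ 2 n) ≡ n
countKind-sum κ zero    _ = refl
countKind-sum κ (suc n) κ<3 with κ n | κ<3 {n} ≤-refl | countKind-sum κ n (λ i<n → κ<3 (m≤n⇒m≤1+n i<n))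
... | 0 | _ | ih = cong suc ih
... | 1 | _ | ih = trans (+-suc _ _) (cong suc ih)
... | 2 | _ | ih = trans (cong (countKind κ 0 n +_) (+-suc _ _)) (trans (+-suc _ _) (cong suc ih))
... | suc (suc (suc _)) | s≤s (s≤s (s≤s ())) | _

-- The search succeeds exactly if there is a witness.

module _ {n : ℕ} {κ : ℕ → ℕ} {α : ℕ → ℕ → ℕ} {M : ℕ → ℕ → ℕ → ℕ}
  (M-κ : ∀ {v} → v < n → M 1 v 0 ≡ κ v) (M-α : ∀ u v → M 0 u v ≡ α u v) where

  private
    bit-zero : ∀ {b} → (bit b ≡ᵇ 0) ≡ true → b ≡ false
    bit-zero {false} _ = refl

    ∧-intro : ∀ {a b} → a ≡ true → b ≡ true → a ∧ b ≡ true
    ∧-intro refl refl = refl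

  module _ (m k : ℕ) where
    open Search n m k M

    via-intro : ∀ {a c b} → b < n → κ b ≡ 1 → α a b ≡ 1 → α b c ≡ 1 → via a c b ≡ true
    via-intro b<n p q r = ∧-intro (≡ᵇ-true (trans (M-κ b<n) p))
      (∧-intro (≡ᵇ-true (trans (M-α _ _) q)) (≡ᵇ-true (trans (M-α _ _) r)))

    bad-intro : ∀ {a c} → c < n → κ c ≡ 2 → α a c ≡ 1 → any (via a c) n ≡ false → bad a c ≡ true
    bad-intro c<n p q r = ∧-intro (≡ᵇ-true (trans (M-κ c<n) p))
      (∧-intro (≡ᵇ-true (trans (M-α _ _) q)) (≡ᵇ-true (cong bit r)))

    any-good⇒Good : any good n ≡ true → ∃[ a ] (a < n × κ a ≡ 0 × Good n κ α a)
    any-good⇒Good e with any⇒∃ good n e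
    ... | a , a<n , g = a , a<n ,
      trans (sym (M-κ a<n)) (≡ᵇ-true⁻¹ (∧-conicalˡ _ _ g)) , triangle
      where
      triangle : Good n κ α a
      triangle {c} c<n p q with any (via a c) n in eq
      ... | false = absurd (∃⇒any (bad a) c<n (bad-intro c<n p q eq))
                      (bit-zero (∧-conicalʳ (M 1 a 0 ≡ᵇ 0) _ g))
      ... | true with any⇒∃ (via a c) n eq
      ...   | b , b<n , v = b , b<n ,
        trans (sym (M-κ b<n)) (≡ᵇ-true⁻¹ (∧-conicalˡ _ _ v)) ,
        trans (sym (M-α a b)) (≡ᵇ-true⁻¹ (∧-conicalˡ _ _ (∧-conicalʳ (M 1 b 0 ≡ᵇ 1) _ v))) ,
        trans (sym (M-α b c)) (≡ᵇ-true⁻¹ (∧-conicalʳ (M 0 a b ≡ᵇ 1) _ (∧-conicalʳ (M 1 b 0 ≡ᵇ 1) _ v)))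

    Good⇒any-good : ∀ {a} → a < n → κ a ≡ 0 → Good n κ α a → any good n ≡ true
    Good⇒any-good {a} a<n p triangle = ∃⇒any good a<n
      (∧-intro (≡ᵇ-true (trans (M-κ a<n) p)) (≡ᵇ-true (cong bit no-bad)))
      where
      no-bad : any (bad a) n ≡ false
      no-bad with any (bad a) n in eq
      ... | false = refl
      ... | true with any⇒∃ (bad a) n eq
      ...   | c , c<n , q =
        let q′ = ∧-conicalʳ (M 1 c 0 ≡ᵇ 2) _ q
            b , b<n , r , s , t = triangle c<n
              (trans (sym (M-κ c<n)) (≡ᵇ-true⁻¹ (∧-conicalˡ _ _ q)))
              (trans (sym (M-α a c)) (≡ᵇ-true⁻¹ (∧-conicalˡ _ _ q′)))
        in absurd (∃⇒any (via a c) b<n (via-intro b<n r s t))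
             (bit-zero (∧-conicalʳ (M 0 a c ≡ᵇ 1) _ q′))

-- Assembling the reduction.

program : ℕ → Cmd
program N = scan ⨾ extend ⨾ parities ⨾ (ifᶜ var 0 << lit N then search ⨾ flatten else skip) ⨾ fill

module Correct {δ : ℚ} (G : Instance δ) where
  open Instance G
  open Encoding graph

  private
    κ = partCode graph
    α = adjBit graph
    c : ℕ → ℕ
    c k = countKind κ k n
    m = n + c 0 + 2
    k = n ∸ c 0 + 3

  encoded : Graph n κ α
  encoded = record
    { κ<3       = λ v<n → subst (_< 3) (sym (partCode-fromℕ< v<n)) (code<3 _)
    ; symmetric = adjBit-sym
    ; neighbour = near
    }
    where
    near : ∀ {v} j → v < n → j < 3 → j ≢ κ v → ∃[ u ] (u < n × κ u ≡ j × α v u ≡ 1)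
    near {v} j v<n j<3 j≢κ with decode j<3
    ... | p , refl with neighbour (fromℕ< v<n) p
                          (λ e → j≢κ (trans (cong code e) (sym (partCode-fromℕ< v<n))))
    ...   | u , u∈p , e = toℕ u , Finₚ.toℕ<n u ,
      trans (partCode-toℕ u) (cong code u∈p) ,
      subst (λ w → α w (toℕ u) ≡ 1) (Finₚ.toℕ-fromℕ< v<n)
        (trans (adjBit-toℕ (fromℕ< v<n) u) (cong bit e))

  open Graph encoded using (κ<3) renaming (neighbour to near)

  yes⇒good : YesInstance G → ∃[ a ] (a < n × κ a ≡ 0 × Good n κ α a)
  yes⇒good (a , a∈A , triangle) = toℕ a , Finₚ.toℕ<n a , trans (partCode-toℕ a) (cong code a∈A) , good
    where
    good : Good n κ α (toℕ a)
    good {c} c<n p e =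
      let c′ = fromℕ< c<n
          c≡ = Finₚ.toℕ-fromℕ< c<n
          b , b∈B , ab , bc , _ = triangle c′
            (code-injective (trans (sym (partCode-fromℕ< c<n)) p))
            (bit-true (trans (sym (adjBit-toℕ a c′)) (trans (cong (α (toℕ a)) c≡) e)))
      in toℕ b , Finₚ.toℕ<n b , trans (partCode-toℕ b) (cong code b∈B) ,
         trans (adjBit-toℕ a b) (cong bit ab) ,
         trans (cong (α (toℕ b)) (sym c≡)) (trans (adjBit-toℕ b c′) (cong bit bc))

  good⇒yes : ∃[ a ] (a < n × κ a ≡ 0 × Good n κ α a) → YesInstance G
  good⇒yes (a , a<n , p , good) = fromℕ< a<n ,
    code-injective (trans (sym (partCode-fromℕ< a<n)) p) , λ c c∈C ac →
      let b , b<n , q , ab , bc = good (Finₚ.toℕ<n c) (trans (partCode-toℕ c) (cong code c∈C))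
            (trans (cong (λ v → α v (toℕ c)) (sym (Finₚ.toℕ-fromℕ< a<n)))
              (trans (adjBit-toℕ (fromℕ< a<n) c) (cong bit ac)))
      in fromℕ< b<n , code-injective (trans (sym (partCode-fromℕ< b<n)) q) ,
         bit-true (trans (sym (adjBit-fromℕ< a<n b<n)) ab) ,
         bit-true (trans (sym (adjBit-toℕ (fromℕ< b<n) c))
           (trans (cong (λ v → α v (toℕ c)) (Finₚ.toℕ-fromℕ< b<n)) bc)) , ac

  -- The three parts add up to `n`, so the truncated subtraction is exact.
  k≡ : k ≡ c 1 + c 2 + 3
  k≡ = cong (_+ 3) (trans (cong (_∸ c 0) (sym (countKind-sum κ n κ<3))) (m+n∸m≡n (c 0) _))

  Correct : ℕ → Memory → Set
  Correct K s = Σ[ T ∈ Tournament m ] (Outputs s T K × (HasKings T K ⇔ YesInstance G))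

  fill-correct : ∀ {s} → reg s 1 ≡ m → reg s 2 ≡ k →
    (HasKings (tournament {m} (tables s)) k ⇔ YesInstance G) →
    Run fill s (fillTime m) (Correct k)
  fill-correct {s} p q kings⇔ = run-weaken
    (λ (order , number , matrix) → tournament (tables s) , record
      { order  = order
      ; number = number
      ; matrix = λ u v → matrix (toℕ u) (toℕ v) (Finₚ.toℕ<n u) (Finₚ.toℕ<n v)
      } , kings⇔)
    (fill-runs p q refl)

  -- The given vertex lies in part `j` or has a neighbour there.
  nonempty : ∀ {v} → v < n → ∀ j → j < 3 → 1 ≤ c j
  nonempty {v} v<n j j<3 with κ v ≟ j
  ... | yes p = ≤-<-trans z≤n (count-< _ (≡ᵇ-true p) v<n)
  ... | no  p = let u , u<n , q , _ = near j v<n j<3 (≢-sym p)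
                in ≤-<-trans z≤n (count-< _ (≡ᵇ-true q) u<n)

  module _ {N : ℕ} (small : n < N) where
    -- The search sets the flag to 0 exactly for a yes-instance. Then all `m` vertices are kings;
    -- otherwise there is at most one king, while the target is at least 3.
    small-runs : ∀ {s} → Parities n κ α m s →
      Run ((ifᶜ var 0 << lit N then search ⨾ flatten else skip) ⨾ fill) s
        (4 + (searchTime n + flattenTime m) + fillTime m) (Correct k)
    small-runs {s} P = run-⨾ {Q = Q} (run-if-true {b = var 0 << lit N}
        (subst (λ i → (i <ᵇ N) ≡ true) (sym order) (<ᵇ-true small))
        (run-⨾ (search-runs (framed refl order order′ target))
          λ { {s′} (goods (framed e o o′ t) _ found) → run-weaken
            (λ {s″} F → Flattened.order F , Flattened.target F , kings F)
            (flatten-runs o′ t found λ {j} j<m → trans (cong (λ M → M 5 j 0) e) (pr-par j<m)) }))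
      λ (p , q , r) → fill-correct p q r
      where
      open Parities P
      open Prepared prepared
      open Search n m k (arr s)

      Q : Memory → Set
      Q s′ = reg s′ 1 ≡ m × reg s′ 2 ≡ k × (HasKings (tournament {m} (tables s′)) k ⇔ YesInstance G)

      found⇒Good = any-good⇒Good {n} {κ} {α} {arr s} (Layout.kd-old layout) (Layout.ad-α layout) m k
      Good⇒found = Good⇒any-good {n} {κ} {α} {arr s} (Layout.kd-old layout) (Layout.ad-α layout) m k

      kings : ∀ {s″} → Flattened m k (bit (not (any good n))) m s″ →
        HasKings (tournament {m} (tables s″)) k ⇔ YesInstance G
      kings {s″} F with any good n in eq
      ... | true  = mk⇔ (λ _ → good⇒yes (found⇒Good eq))
        λ _ → flat-all-kings record { Flattened F } (Flattened.fl-f F) 5≤m k≤m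
        where
        v<n = proj₁ (proj₂ (found⇒Good eq))
        1≤c0 = nonempty v<n 0 (s≤s z≤n)
        sum = countKind-sum κ n κ<3

        -- |B| + |C| is at most `n`, and |A| is at least 1.
        k≤m : k ≤ m
        k≤m = begin
          k                           ≡⟨ k≡ ⟩
          c 1 + c 2 + (1 + 2)         ≡⟨ +-assoc (c 1 + c 2) 1 2 ⟨
          c 1 + c 2 + 1 + 2           ≤⟨ +-monoˡ-≤ 2
            (+-mono-≤ (≤-trans (m≤n+m (c 1 + c 2) (c 0)) (≤-reflexive sum)) 1≤c0) ⟩
          m                           ∎
          where open ≤-Reasoning

        -- B and C are nonempty, so `k` is already at least 1 + 1 + 3.
        5≤m : 5 ≤ m
        5≤m = ≤-trans (≤-trans (+-monoˡ-≤ 3 (+-mono-≤ (nonempty v<n 1 (s≤s (s≤s z≤n)))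
          (nonempty v<n 2 ≤-refl)))
          (≤-reflexive (sym k≡))) k≤m
      ... | false = mk⇔
        (λ kings → ⊥-elim (flat-one-king record { Flattened F } (Flattened.fl-f F)
          (≤-trans (s≤s (s≤s z≤n)) (m≤n+m 3 (n ∸ c 0))) kings))
        λ yes′ → let a , a<n , p , good = yes⇒good yes′ in
          absurd (Good⇒found a<n p good) eq

  module _ {N : ℕ} (N≤n : N ≤ n) (0<n : 0 < n) (5≤B : 5 ≤ c 1) (5≤C : 5 ≤ c 2) where
    large-runs : ∀ {s} → Parities n κ α m s →
      Run ((ifᶜ var 0 << lit N then search ⨾ flatten else skip) ⨾ fill) s
        (5 + fillTime m) (Correct k)
    large-runs {s} P = run-⨾ {Q = _≡ s} (run-if-false {b = var 0 << lit N}
        (subst (λ i → (i <ᵇ N) ≡ false) (sym order) (<ᵇ-false N≤n))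
        (run-straight skip _ refl))
      λ { refl → fill-correct order′ target kings }
      where
      open Parities P
      open Prepared prepared
      open Main encoded layout
        (λ j<n → pr-par (<-≤-trans j<n (≤-trans (m≤m+n n (c 0)) (m≤m+n _ 2)))) 0<n 5≤B 5≤C
        using (kings⇒good; good⇒kings)

      kings : HasKings (tournament {n + c 0 + 2} (tables s)) k ⇔ YesInstance G
      kings = mk⇔ (λ h → good⇒yes (kings⇒good (subst (HasKings _) k≡ h)))
        λ yes′ → let a , a<n , p , good = yes⇒good yes′ in
          subst (HasKings _) (sym k≡) (good⇒kings a<n p good)

  -- The time `τ` of the remainder is left open, since it is cubic below the threshold and quadratic
  -- above it.
  prefix-runs : ∀ {N τ} →
    (∀ {s} → Parities n κ α m s →
      Run ((ifᶜ var 0 << lit N then search ⨾ flatten else skip) ⨾ fill) s τ (Correct k)) →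
    Run (program N) (load graph)
      (2 + (n * (4 + time scanStep) + 4) + (time extend + (m * (4 + time parityStep) + 4 + τ)))
      (Correct k)
  prefix-runs rest =
    run-⨾ (scan-runs n κ α start) λ S →
    run-⨾ (run-straight extend _ (extend-prepares n κ α S)) λ P →
    run-⨾ (parities-runs n κ α P) rest
    where
    start : Scanned n κ α 0 (exec (4 := var 0) (load graph))
    start = record
      { order = refl ; index = refl ; next = sym (+-identityʳ n) ; others = refl ; fl-0 = refl
      ; ad-α = λ _ _ → refl ; kd-old = λ _ → refl ; og-old = λ () ; rk-old = λ ()
      ; kd-copy = λ () ; og-copy = λ () ; mk-size = λ _ → refl }

-- The type of `T` depends on |A|. With |A| as a separate number `a`, one substitution exchanges the
-- count of kind 0 for the size of the part.
Reduction : ∀ {δ} → Instance δ → Cmd → ℕ → ℕ → ℕ → Set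
Reduction G P c n₀ a =
  let n  = Instance.n G
      n′ = n + a + 2
      k  = n ∸ a + 3
  in
  Σ[ T ∈ Tournament n′ ] Σ[ s ∈ Memory ] Σ[ time ∈ ℕ ]
    (⟨ P , load (Instance.graph G) ⟩⇓[ time ] s ×
     (n₀ ≤ n → time ≤ c * n ^ 2) ×
     Outputs s T k ×
     (HasKings T k ⇔ YesInstance G))

reduction : ∀ {δ} → 0ℚ <ℚ δ → (G : Instance δ) → let N = 5 * ℚ.↧ₙ δ in
  Reduction G (program N) (totalTime 1 3) N (countKind (partCode (Instance.graph G)) 0 (Instance.n G))
reduction {δ} 0<δ G with Instance.n G <? 5 * ℚ.↧ₙ δ
... | yes n<N =
  let s , t , ⇓ , _ , T , outputs , kings = Correct.prefix-runs G (Correct.small-runs G n<N)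
  -- No time bound is claimed below the threshold, which accommodates the cubic search.
  in T , s , t , ⇓ , (λ N≤n → contradiction n<N (≤⇒≯ N≤n)) , outputs , kings
... | no n≮N =
  let N≤n  = ≮⇒≥ n≮N
      5≤ p = large n (size p) 0<δ N≤n (balanced p)
      -- A denominator is at least 1, so the threshold is at least 5.
      5≤n  = ≤-trans (*-monoʳ-≤ 5 {1} {ℚ.↧ₙ δ} (s≤s z≤n)) N≤n
      s , t , ⇓ , t≤ , T , outputs , kings = Correct.prefix-runs G
        (Correct.large-runs G N≤n (≤-trans (s≤s z≤n) 5≤n)
          (subst (5 ≤_) (size-count B) (5≤ B)) (subst (5 ≤_) (size-count C) (5≤ C)))
  in T , s , t , ⇓ ,
     (λ _ → ≤-trans t≤ (totalTime-quadratic {n} (≤-trans (s≤s z≤n) 5≤n) (m≤3n 5≤n))) ,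
     outputs , kings
  where
  open Instance G
  open Encoding graph
  m≤3n : 5 ≤ n → n + countKind (partCode graph) 0 n + 2 ≤ 3 * n
  m≤3n 5≤n = begin
    n + countKind (partCode graph) 0 n + 2 ≤⟨ +-mono-≤ (+-monoʳ-≤ n (count≤ _ n))
      (≤-trans (s≤s (s≤s z≤n)) 5≤n) ⟩
    n + n + n                              ≡⟨ +-assoc n n n ⟩
    n + (n + n)                            ≡⟨ cong (λ k → n + (n + k)) (+-identityʳ n) ⟨
    3 * n                                  ∎
    where open ≤-Reasoning

theorem4p5 : (δ : ℚ) → 0ℚ <ℚ δ →
    Σ[ P ∈ Cmd ] Σ[ c ∈ ℕ ] Σ[ n₀ ∈ ℕ ]
    ((G : Instance δ) →
    let n  = Instance.n G
        n′ = n + Instance.size G A + 2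
        k  = n ∸ Instance.size G A + 3
    in
    Σ[ T ∈ Tournament n′ ] Σ[ s ∈ Memory ] Σ[ time ∈ ℕ ]
    (⟨ P , load (Instance.graph G) ⟩⇓[ time ] s ×
    (n₀ ≤ n → time ≤ c * n ^ 2) ×
    Outputs s T k ×
    (HasKings T k ⇔ YesInstance G)))
-- δ enters through the threshold `N` alone; the coefficient of the time bound is the same for all
-- δ.
theorem4p5 δ 0<δ = program N , totalTime 1 3 , N , λ G →
  subst (Reduction G (program N) (totalTime 1 3) N)
    (sym (Encoding.size-count (Instance.graph G) A)) (reduction 0<δ G)
  where N = 5 * ℚ.↧ₙ δ
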